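{- Let $l\ge 1$ and let $\Gamma_1,\ldots,\Gamma_l$ be finite, non-empty, connected graphs with $k_1,\ldots,k_l$ vertices respectively, and let $\Gamma_J$ be their join. Let $k=\sum_{i=1}^l k_i$ be the number of vertices of $\Gamma_J$. Then \[ |\operatorname{Pic}^0(\Gamma_J)| = k^{l-2}\prod_{i=1}^{l}|P_{\Gamma_i}(k_i-k)|, \] where $P_{\Gamma_i}(x)$ is the characteristic polynomial of the rational Laplacian operator of $\Gamma_i$.
   Context: The join of graphs $\Gamma_1,\dots,\Gamma_l$ is obtained from their disjoint union by adding an edge between every vertex of $\Gamma_i$ and every vertex of $\Gamma_j$ for all $i\neq j$. For a graph $\Gamma$, $\operatorname{Div}(\Gamma)$ is the free abelian group on $V(\Gamma)$, $\operatorname{Div}^0(\Gamma)$ is the kernel of the degree map $\sum a_v v\mapsto \sum a_v$, the Laplacian $\Delta(\Gamma):\operatorname{Div}(\Gamma)\to\operatorname{Div}^0(\Gamma)$ is given by $v\mapsto (\deg v)\,v-\sum_{wv\in E(\Gamma)} w$, and $\operatorname{Pic}^0(\Gamma)=\operatorname{Div}^0(\Gamma)/\operatorname{im}\Delta(\Gamma)$. The rational Laplacian operator is the endomorphism of $\operatorname{Div}^0(\Gamma)\otimes_{\mathbb{Z}}\mathbb{Q}$ induced by $\Delta(\Gamma)$, and $P_\Gamma(x)$ is its characteristic polynomial, with the convention $P_\Gamma(x)=1$ if $\Gamma$ has one vertex. -}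

module Defs where

open import Data.Bool using (Bool; true; false; if_then_else_)
open import Data.Nat as ℕ using (ℕ; zero; suc)
open import Data.Integer as ℤ using (ℤ; +_; _+_; _-_; _*_; -_; ∣_∣)
open import Data.Fin using (Fin; zero; suc; splitAt; punchIn; _≟_; fromℕ; inject₁)
open import Data.Vec using (Vec; []; _∷_; lookup; sum)
open import Data.Product using (Σ; _,_; _×_; ∃; Σ-syntax; ∃-syntax)
open import Data.Sum using (_⊎_; inj₁; inj₂)
open import Relation.Nullary using (yes; no)
open import Relation.Binary.PropositionalEquality using (_≡_; refl)

Σℤ : ∀ n → (Fin n → ℤ) → ℤ
Σℤ zero    f = + 0
Σℤ (suc n) f = f zero + Σℤ n (λ i → f (suc i))

Πℕ : ∀ n → (Fin n → ℕ) → ℕ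
Πℕ zero    f = 1
Πℕ (suc n) f = f zero ℕ.* Πℕ n (λ i → f (suc i))

Matrix : ℕ → Set
Matrix n = Fin n → Fin n → ℤ

sign : ∀ {n} → Fin n → ℤ
sign zero    = + 1
sign (suc i) = - sign i

det : ∀ n → Matrix n → ℤ
det zero    M = + 1
det (suc n) M =
  Σℤ (suc n) (λ j → sign j * M zero j * det n (λ r c → M (suc r) (punchIn j c)))

record Graph (n : ℕ) : Set where
  field
    adj    : Fin n → Fin n → Bool
    sym    : ∀ u v → adj u v ≡ adj v u
    irrefl : ∀ v → adj v v ≡ false
open Graph public

data Reach {n} (G : Graph n) : Fin n → Fin n → Set where
  here : ∀ {v} → Reach G v v
  step : ∀ {u v w} → adj G u v ≡ true → Reach G v w → Reach G u w

Connected : ∀ {n} → Graph n → Set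
Connected {n} G = ∀ (u v : Fin n) → Reach G u v

b2ℤ : Bool → ℤ
b2ℤ b = if b then + 1 else + 0

degree : ∀ {n} → Graph n → Fin n → ℤ
degree {n} G v = Σℤ n (λ w → b2ℤ (adj G v w))

lap : ∀ {n} → Graph n → Matrix n
lap G w v with w ≟ v
... | yes _ = degree G v
... | no  _ = - b2ℤ (adj G w v)

Div : ℕ → Set
Div n = Fin n → ℤ

deg : ∀ {n} → Div n → ℤ
deg {n} D = Σℤ n D

Δ : ∀ {n} → Graph n → Div n → Div n
Δ {n} G D w = Σℤ n (λ v → D v * lap G w v)

LinEquiv : ∀ {n} → Graph n → Div n → Div n → Set
LinEquiv {n} G D D' = Σ[ x ∈ Div n ] (∀ w → D w - D' w ≡ Δ G x w)

-- Pic^0(G) = Div^0(G)/im Δ has exactly N elements: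
-- a bijection from Fin N onto the quotient (setoid) Div^0 / ~.
PicCard : ∀ {n} → Graph n → ℕ → Set
PicCard {n} G N =
  Σ[ f ∈ (Fin N → Div n) ]
    ((∀ i → deg (f i) ≡ + 0)
    × (∀ i j → LinEquiv G (f i) (f j) → i ≡ j)
    × (∀ (D : Div n) → deg D ≡ + 0 → ∃[ i ] LinEquiv G D (f i)))

-- Characteristic polynomial of the rational Laplacian on Div^0 ⊗ ℚ,
-- evaluated at an integer x.  Matrix w.r.t. the ℚ-basis
-- b_i = v_i - v_last (i < n-1) of Div^0 ⊗ ℚ; coordinate j of D ∈ Div^0 is D_j.
-- For n = 1 this is the empty matrix and P = 1 (the stated convention).

lapDiv0 : ∀ {m} → Graph (suc m) → Matrix m
lapDiv0 {m} G j i = lap G (inject₁ j) (inject₁ i) - lap G (inject₁ j) (fromℕ m)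

charPolyAt : ∀ {n} → Graph n → ℤ → ℤ
charPolyAt {zero}  G x = + 1   -- no such graphs are used (non-empty)
charPolyAt {suc m} G x =
  det m (λ i j → (if isEq i j then x else + 0) - lapDiv0 G i j)
  where
  isEq : Fin m → Fin m → Bool
  isEq i j with i ≟ j
  ... | yes _ = true
  ... | no  _ = false

decode : ∀ {l} (ks : Vec ℕ l) → Fin (sum ks) → Σ (Fin l) (λ i → Fin (lookup ks i))
decode (k ∷ ks) x with splitAt k x
... | inj₁ a = zero , a
... | inj₂ b with decode ks b
...   | i , c = suc i , c

joinAdj : ∀ {l} (ks : Vec ℕ l) → ((i : Fin l) → Graph (lookup ks i)) →
          Σ (Fin l) (λ i → Fin (lookup ks i)) → Σ (Fin l) (λ i → Fin (lookup ks i)) → Bool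
joinAdj ks Γ (i , a) (j , b) with i ≟ j
... | yes refl = adj (Γ i) a b
... | no  _    = true

joinSym : ∀ {l} (ks : Vec ℕ l) (Γ : (i : Fin l) → Graph (lookup ks i)) →
          ∀ p q → joinAdj ks Γ p q ≡ joinAdj ks Γ q p
joinSym ks Γ (i , a) (j , b) with i ≟ j | j ≟ i
... | yes refl | yes refl = sym (Γ i) a b
... | yes refl | no  ne   with ne refl
...   | ()
joinSym ks Γ (i , a) (j , b) | no ne | yes refl with ne refl
...   | ()
joinSym ks Γ (i , a) (j , b) | no _ | no _ = refl

joinIrrefl : ∀ {l} (ks : Vec ℕ l) (Γ : (i : Fin l) → Graph (lookup ks i)) →
             ∀ p → joinAdj ks Γ p p ≡ false
joinIrrefl ks Γ (i , a) with i ≟ i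
... | yes refl = irrefl (Γ i) a
... | no ne with ne refl
...   | ()

join : ∀ {l} (ks : Vec ℕ l) → ((i : Fin l) → Graph (lookup ks i)) → Graph (sum ks)
join ks Γ = record
  { adj    = λ u v → joinAdj ks Γ (decode ks u) (decode ks v)
  ; sym    = λ u v → joinSym ks Γ (decode ks u) (decode ks v)
  ; irrefl = λ u → joinIrrefl ks Γ (decode ks u)
  }

{-# OPTIONS --safe #-}

-- Write L for the Laplacian of the join and J for the all-ones matrix.  Then L + J is block
-- diagonal, with blocks T_i = L_i + (k - k_i) I + J, because the join has all edges between
-- different blocks.  The determinants are compared through orders of cokernels:
-- an integer matrix whose image is annihilated by no nonzero covector has a cokernel of
-- order |det|.  Each T_i multiplies degrees by k and restricts to L_i + (k - k_i) I on Div⁰, so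
-- its cokernel has order k |P_i(k_i - k)|.  On the other hand coker (L + J) has order k² |Pic⁰|:
-- one factor k comes from the degree, the other one from L(Div) / L(Div⁰).
-- Nondegeneracy follows from a maximum principle.
module Submission where

open import Defs hiding (sym)
open import Algebra.Properties.AbelianGroup using (∙-cancelˡ)
open import Data.Bool using (true; false)
open import Data.Nat as ℕ using (ℕ; zero; suc)
import Data.Nat.Properties as ℕ
open import Data.Integer as ℤ using (ℤ; +_; _+_; _-_; _*_; -_; ∣_∣; 0ℤ; 1ℤ)
import Data.Integer.Properties as ℤ
import Data.Integer.DivMod as ℤ
open import Data.Integer.Tactic.RingSolver using (solve-∀)
open import Data.Fin using (Fin; zero; suc; punchIn; punchOut; _≟_; fromℕ; fromℕ<; inject₁; toℕ; combine; remQuot; splitAt; _↑ˡ_; _↑ʳ_)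
import Data.Fin.Properties as Fin
open import Data.List using (List; []; _∷_; _++_; map)
open import Data.Vec using (Vec; []; _∷_; lookup; sum)
open import Data.Product using (_,_; _×_; Σ-syntax; ∃-syntax; proj₁; proj₂; map₁)
open import Data.Sum using (_⊎_; inj₁; inj₂; [_,_]′)
open import Data.Unit using (⊤; tt)
open import Function using (_∘_; id)
open import Relation.Nullary using (yes; no; contradiction)
open import Relation.Binary.PropositionalEquality using (_≡_; _≢_; refl; sym; trans; cong; cong₂; subst; module ≡-Reasoning)

-- Working with orders of cokernels replaces the multiplicativity of determinants. Beyond its
-- expansion along the first row, what is used of `det` is that a Euclidean step on two adjacent
-- columns negates it, while the same step leaves the image unchanged. On Div⁰ the operator L_i + (k
-- - k_i) I is minus x I - L_i at x = k_i - k; neither the image nor the absolute value of the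
-- determinant sees this sign, which explains the argument of the characteristic polynomial. The
-- parameter `k` of `shifted` is independent of the size of the graph, so one formula describes the
-- matrix of the join and each of its blocks. The kernel of the join's Laplacian is also read off
-- the blocks, so no paths in the join are constructed.

private variable
  m n : ℕ

-- Finite sums and the Kronecker delta

Σ-cong : ∀ {n} {f g : Fin n → ℤ} → (∀ i → f i ≡ g i) → Σℤ n f ≡ Σℤ n g
Σ-cong {zero}  h = refl
Σ-cong {suc n} h = cong₂ _+_ (h zero) (Σ-cong (h ∘ suc))

Σ-zero : ∀ n → Σℤ n (λ _ → 0ℤ) ≡ 0ℤ
Σ-zero zero    = refl
Σ-zero (suc n) = trans (ℤ.+-identityˡ _) (Σ-zero n)

Σ-vanish : ∀ {n} {f : Fin n → ℤ} → (∀ i → f i ≡ 0ℤ) → Σℤ n f ≡ 0ℤ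
Σ-vanish {n} h = trans (Σ-cong h) (Σ-zero n)

i+j-j≡i : ∀ i j → i + j - j ≡ i
i+j-j≡i = solve-∀

+-interchange : ∀ a b c d → (a + b) + (c + d) ≡ (a + c) + (b + d)
+-interchange = solve-∀

Σ-+ : ∀ {n} (f g : Fin n → ℤ) → Σℤ n (λ i → f i + g i) ≡ Σℤ n f + Σℤ n g
Σ-+ {zero}  f g = refl
Σ-+ {suc n} f g = trans (cong (_+_ (f zero + g zero)) (Σ-+ (f ∘ suc) (g ∘ suc)))
                        (+-interchange (f zero) (g zero) _ _)

Σ-*ˡ : ∀ {n} c (f : Fin n → ℤ) → Σℤ n (λ i → c * f i) ≡ c * Σℤ n f
Σ-*ˡ {zero}  c f = sym (ℤ.*-zeroʳ c)
Σ-*ˡ {suc n} c f = trans (cong (_+_ (c * f zero)) (Σ-*ˡ c (f ∘ suc)))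
                         (sym (ℤ.*-distribˡ-+ c _ _))

Σ-*ʳ : ∀ {n} c (f : Fin n → ℤ) → Σℤ n (λ i → f i * c) ≡ Σℤ n f * c
Σ-*ʳ c f = trans (Σ-cong (λ i → ℤ.*-comm (f i) c)) (trans (Σ-*ˡ c f) (ℤ.*-comm c _))

Σ-neg : ∀ {n} (f : Fin n → ℤ) → Σℤ n (λ i → - f i) ≡ - Σℤ n f
Σ-neg f = trans (Σ-cong (λ i → sym (ℤ.-1*i≡-i (f i)))) (trans (Σ-*ˡ (- 1ℤ) f) (ℤ.-1*i≡-i _))

Σ-- : ∀ {n} (f g : Fin n → ℤ) → Σℤ n (λ i → f i - g i) ≡ Σℤ n f - Σℤ n g
Σ-- f g = trans (Σ-+ f (λ i → - g i)) (cong (_+_ (Σℤ _ f)) (Σ-neg g))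

Σ-swap : ∀ {m n} (f : Fin m → Fin n → ℤ) →
         Σℤ m (λ i → Σℤ n (f i)) ≡ Σℤ n (λ j → Σℤ m (λ i → f i j))
Σ-swap {zero}  {n} f = sym (Σ-zero n)
Σ-swap {suc m} {n} f = trans (cong (_+_ (Σℤ n (f zero))) (Σ-swap (f ∘ suc)))
                             (sym (Σ-+ (f zero) _))

Σ-last : ∀ {n} (f : Fin (suc n) → ℤ) → Σℤ (suc n) f ≡ Σℤ n (f ∘ inject₁) + f (fromℕ n)
Σ-last {zero}  f = ℤ.+-comm (f zero) 0ℤ
Σ-last {suc n} f = trans (cong (_+_ (f zero)) (Σ-last (f ∘ suc))) (sym (ℤ.+-assoc (f zero) _ _))

δ : ∀ {n} → Fin n → Fin n → ℤ
δ zero    zero    = 1ℤ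
δ zero    (suc _) = 0ℤ
δ (suc _) zero    = 0ℤ
δ (suc i) (suc j) = δ i j

δ-refl : ∀ {n} (i : Fin n) → δ i i ≡ 1ℤ
δ-refl zero    = refl
δ-refl (suc i) = δ-refl i

δ-≢ : ∀ {n} {i j : Fin n} → i ≢ j → δ i j ≡ 0ℤ
δ-≢ {i = zero}  {zero}  p = contradiction refl p
δ-≢ {i = zero}  {suc _} p = refl
δ-≢ {i = suc _} {zero}  p = refl
δ-≢ {i = suc _} {suc _} p = δ-≢ (p ∘ cong suc)

δ-sym : ∀ {n} (i j : Fin n) → δ i j ≡ δ j i
δ-sym zero    zero    = refl
δ-sym zero    (suc _) = refl
δ-sym (suc _) zero    = refl
δ-sym (suc i) (suc j) = δ-sym i j

Σ-δ : ∀ {n} (f : Fin n → ℤ) i → Σℤ n (λ j → f j * δ i j) ≡ f i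
Σ-δ f zero    = trans (cong₂ _+_ (ℤ.*-identityʳ (f zero)) (Σ-vanish (λ j → ℤ.*-zeroʳ (f (suc j))))) (ℤ.+-identityʳ (f zero))
Σ-δ f (suc i) = trans (cong₂ _+_ (ℤ.*-zeroʳ (f zero)) (Σ-δ (f ∘ suc) i)) (ℤ.+-identityˡ _)

-- Determinants under column operations

det-cong : ∀ n {A B : Matrix n} → (∀ r c → A r c ≡ B r c) → det n A ≡ det n B
det-cong zero    h = refl
det-cong (suc n) h = Σ-cong λ j →
  cong₂ _*_ (cong (sign j *_) (h zero j)) (det-cong n (λ r c → h (suc r) (punchIn j c)))

minor : Matrix (suc n) → Fin (suc n) → ℤ
minor {n} M j = det n (λ r c → M (suc r) (punchIn j c))

-- In the expansion along the first row, the summand of column `i` carries the difference in its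
-- entry; in every other summand it sits in the minor, where column `i` survives at position
-- `punchOut j≢i`.
det-linear-col : ∀ n {A B C : Matrix n} q (i : Fin n) →
                 (∀ r → A r i ≡ B r i - q * C r i) →
                 (∀ r c → c ≢ i → A r c ≡ B r c) → (∀ r c → c ≢ i → A r c ≡ C r c) →
                 det n A ≡ det n B - q * det n C
det-linear-col (suc n) {A} {B} {C} q i col offB offC =
  trans (Σ-cong term) (trans (Σ-- (summand B) (λ j → q * summand C j)) (cong (_-_ (det (suc n) B)) (Σ-*ˡ q (summand C))))
  where
  summand : Matrix (suc n) → Fin (suc n) → ℤ
  summand M j = sign j * M zero j * minor M j
  entry : ∀ s b q c d → s * (b - q * c) * d ≡ s * b * d - q * (s * c * d)
  entry = solve-∀
  inMinor : ∀ s a q d e → s * a * (d - q * e) ≡ s * a * d - q * (s * a * e)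
  inMinor = solve-∀
  term : ∀ j → sign j * A zero j * minor A j
             ≡ sign j * B zero j * minor B j - q * (sign j * C zero j * minor C j)
  term j with j ≟ i
  ... | yes refl = begin
    sign j * A zero j * minor A j
      ≡⟨ cong (λ a → sign j * a * minor A j) (col zero) ⟩
    sign j * (B zero j - q * C zero j) * minor A j
      ≡⟨ entry (sign j) (B zero j) q (C zero j) (minor A j) ⟩
    sign j * B zero j * minor A j - q * (sign j * C zero j * minor A j)
      ≡⟨ cong₂ (λ b c → sign j * B zero j * b - q * (sign j * C zero j * c))
           (det-cong n (λ r c → offB (suc r) (punchIn j c) (Fin.punchInᵢ≢i j c)))
           (det-cong n (λ r c → offC (suc r) (punchIn j c) (Fin.punchInᵢ≢i j c))) ⟩
    sign j * B zero j * minor B j - q * (sign j * C zero j * minor C j) ∎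
    where open ≡-Reasoning
  ... | no j≢i = begin
    sign j * A zero j * minor A j
      ≡⟨ cong (sign j * A zero j *_) (det-linear-col n q (punchOut j≢i)
           (λ r → subst (λ c → A (suc r) c ≡ B (suc r) c - q * C (suc r) c)
                        (sym (Fin.punchIn-punchOut j≢i)) (col (suc r)))
           (λ r c c≢ → offB (suc r) (punchIn j c) (away c≢))
           (λ r c c≢ → offC (suc r) (punchIn j c) (away c≢))) ⟩
    sign j * A zero j * (minor B j - q * minor C j)
      ≡⟨ inMinor (sign j) (A zero j) q (minor B j) (minor C j) ⟩
    sign j * A zero j * minor B j - q * (sign j * A zero j * minor C j)
      ≡⟨ cong₂ (λ b c → sign j * b * minor B j - q * (sign j * c * minor C j))
           (offB zero j j≢i) (offC zero j j≢i) ⟩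
    sign j * B zero j * minor B j - q * (sign j * C zero j * minor C j) ∎
    where
    open ≡-Reasoning
    away : ∀ {c} → c ≢ punchOut j≢i → punchIn j c ≢ i
    away c≢ e = c≢ (Fin.punchIn-injective j _ _ (trans e (sym (Fin.punchIn-punchOut j≢i))))

-- On two adjacent coordinates this is the matrix with rows (0, 1) and (1, -q). Swap and subtraction
-- are merged so that one kind of operation runs the whole Euclidean algorithm, and adjacency keeps
-- the signs of the expansion under control.
euclid : Fin n → ℤ → (Fin (suc n) → ℤ) → Fin (suc n) → ℤ
euclid zero    q a zero          = a (suc zero)
euclid zero    q a (suc zero)    = a zero - q * a (suc zero)
euclid zero    q a (suc (suc j)) = a (suc (suc j))
euclid (suc i) q a zero          = a zero
euclid (suc i) q a (suc j)       = euclid i q (a ∘ suc) j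

euclid-fst : ∀ (i : Fin n) q a → euclid i q a (inject₁ i) ≡ a (suc i)
euclid-fst zero    q a = refl
euclid-fst (suc i) q a = euclid-fst i q (a ∘ suc)

euclid-snd : ∀ (i : Fin n) q a → euclid i q a (suc i) ≡ a (inject₁ i) - q * a (suc i)
euclid-snd zero    q a = refl
euclid-snd (suc i) q a = euclid-snd i q (a ∘ suc)

euclid-off : ∀ (i : Fin n) q a {j} → j ≢ inject₁ i → j ≢ suc i → euclid i q a j ≡ a j
euclid-off zero    q a {zero}        p r = contradiction refl p
euclid-off zero    q a {suc zero}    p r = contradiction refl r
euclid-off zero    q a {suc (suc j)} p r = refl
euclid-off (suc i) q a {zero}        p r = refl
euclid-off (suc i) q a {suc j}       p r = euclid-off i q (a ∘ suc) (p ∘ cong suc) (r ∘ cong suc)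

-- Deleting another column keeps the two affected ones adjacent, so the minor undergoes the same
-- step, one position earlier if the deleted column precedes them. The position is chosen before `q`
-- and `a` because it has to serve all rows at once.
euclid-punchIn : ∀ (i : Fin (suc n)) (j : Fin (suc (suc n))) → j ≢ inject₁ i → j ≢ suc i →
                 ∃[ i′ ] (∀ q a c → euclid i q a (punchIn j c) ≡ euclid {n} i′ q (a ∘ punchIn j) c)
euclid-punchIn zero zero       p r = contradiction refl p
euclid-punchIn zero (suc zero) p r = contradiction refl r
euclid-punchIn {suc n} zero (suc (suc j)) p r = zero , λ where
  q a zero          → refl
  q a (suc zero)    → refl
  q a (suc (suc c)) → refl
euclid-punchIn {suc n} (suc i) zero    p r = i , λ q a c → refl
euclid-punchIn {suc n} (suc i) (suc j) p r with euclid-punchIn i j (p ∘ cong suc) (r ∘ cong suc)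
... | i′ , h = suc i′ , λ where
  q a zero    → refl
  q a (suc c) → h q (a ∘ suc) c

-- In `det-euclid` the summands at the two affected columns change sign only jointly, since their
-- `q`-terms cancel against each other; hence the hypothesis on their sum.
Σ-adjacent : ∀ (i : Fin n) {f g : Fin (suc n) → ℤ} →
             f (inject₁ i) + f (suc i) ≡ - (g (inject₁ i) + g (suc i)) →
             (∀ j → j ≢ inject₁ i → j ≢ suc i → f j ≡ - g j) →
             Σℤ (suc n) f ≡ - Σℤ (suc n) g
Σ-adjacent {suc n} zero {f} {g} e h = begin
  f zero + (f (suc zero) + Σℤ n (λ j → f (suc (suc j))))
    ≡⟨ ℤ.+-assoc (f zero) _ _ ⟨
  f zero + f (suc zero) + Σℤ n (λ j → f (suc (suc j)))
    ≡⟨ cong₂ _+_ e (trans (Σ-cong (λ j → h (suc (suc j)) (λ ()) (λ ()))) (Σ-neg (λ j → g (suc (suc j))))) ⟩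
  - (g zero + g (suc zero)) + - Σℤ n (λ j → g (suc (suc j)))
    ≡⟨ regroup (g zero) (g (suc zero)) _ ⟩
  - (g zero + (g (suc zero) + Σℤ n (λ j → g (suc (suc j))))) ∎
  where
  open ≡-Reasoning
  regroup : ∀ a b c → - (a + b) + - c ≡ - (a + (b + c))
  regroup = solve-∀
Σ-adjacent {suc n} (suc i) {f} {g} e h = trans
  (cong₂ _+_ (h zero (λ ()) (λ ()))
     (Σ-adjacent i e (λ j p r → h (suc j) (p ∘ Fin.suc-injective) (r ∘ Fin.suc-injective))))
  (sym (ℤ.neg-distrib-+ (g zero) _))

sign-inject₁ : ∀ (i : Fin n) → sign (inject₁ i) ≡ sign i
sign-inject₁ zero    = refl
sign-inject₁ (suc i) = cong -_ (sign-inject₁ i)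

punchIn-adjacent : ∀ (i c : Fin n) → c ≢ i → punchIn (inject₁ i) c ≡ punchIn (suc i) c
punchIn-adjacent zero    zero    p = contradiction refl p
punchIn-adjacent zero    (suc c) p = refl
punchIn-adjacent (suc i) zero    p = refl
punchIn-adjacent (suc i) (suc c) p = cong suc (punchIn-adjacent i c (p ∘ cong suc))

punchIn-inject₁-self : ∀ (i : Fin n) → punchIn (inject₁ i) i ≡ suc i
punchIn-inject₁-self zero    = refl
punchIn-inject₁-self (suc i) = cong suc (punchIn-inject₁-self i)

punchIn-suc-self : ∀ (i : Fin n) → punchIn (suc i) i ≡ inject₁ i
punchIn-suc-self zero    = refl
punchIn-suc-self (suc i) = cong suc (punchIn-suc-self i)

punchIn-suc-≢ : ∀ (i c : Fin n) → c ≢ i → punchIn (suc i) c ≢ inject₁ i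
punchIn-suc-≢ i c p e = p (Fin.punchIn-injective (suc i) c i (trans e (sym (punchIn-suc-self i))))

det-euclid : ∀ n (i : Fin n) q (M : Matrix (suc n)) →
             det (suc n) (λ r → euclid i q (M r)) ≡ - det (suc n) M
det-euclid (suc n) i q M = Σ-adjacent i pair other
  where
  E : Matrix (suc (suc n))
  E r = euclid i q (M r)
  off : ∀ r c → c ≢ i → E r (punchIn (suc i) c) ≡ M r (punchIn (suc i) c)
  off r c c≢i = euclid-off i q (M r) (punchIn-suc-≢ i c c≢i) (Fin.punchInᵢ≢i (suc i) c)
  -- With column `suc i` deleted, what remains of the affected pair is the old column `suc i`, now
  -- in position `inject₁ i`.
  minor-snd : minor E (suc i) ≡ minor M (inject₁ i)
  minor-snd = det-cong (suc n) λ r c → go r c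
    where
    go : ∀ r c → E (suc r) (punchIn (suc i) c) ≡ M (suc r) (punchIn (inject₁ i) c)
    go r c with c ≟ i
    ... | yes refl = trans (cong (E (suc r)) (punchIn-suc-self c))
                       (trans (euclid-fst c q (M (suc r))) (cong (M (suc r)) (sym (punchIn-inject₁-self c))))
    ... | no c≢i   = trans (off (suc r) c c≢i) (cong (M (suc r)) (sym (punchIn-adjacent i c c≢i)))
  -- With column `inject₁ i` deleted, the difference column remains, and linearity splits it into
  -- the two minors of `M`.
  minor-fst : minor E (inject₁ i) ≡ minor M (suc i) - q * minor M (inject₁ i)
  minor-fst = det-linear-col (suc n) q i
    (λ r → trans (cong (E (suc r)) (punchIn-inject₁-self i))
      (trans (euclid-snd i q (M (suc r)))
        (cong₂ (λ b c → M (suc r) b - q * M (suc r) c)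
          (sym (punchIn-suc-self i)) (sym (punchIn-inject₁-self i)))))
    (λ r c c≢i → trans (cong (E (suc r)) (punchIn-adjacent i c c≢i)) (off (suc r) c c≢i))
    (λ r c c≢i → trans (cong (E (suc r)) (punchIn-adjacent i c c≢i))
       (trans (off (suc r) c c≢i) (cong (M (suc r)) (sym (punchIn-adjacent i c c≢i)))))
  cancel : ∀ s a b q d e → s * b * (e - q * d) + - s * (a - q * b) * d ≡ - (s * a * d + - s * b * e)
  cancel = solve-∀
  pair : sign (inject₁ i) * E zero (inject₁ i) * minor E (inject₁ i)
           + - sign i * E zero (suc i) * minor E (suc i)
       ≡ - (sign (inject₁ i) * M zero (inject₁ i) * minor M (inject₁ i)
           + - sign i * M zero (suc i) * minor M (suc i))
  pair rewrite sign-inject₁ i | euclid-fst i q (M zero) | euclid-snd i q (M zero) | minor-fst | minor-snd =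
    cancel (sign i) (M zero (inject₁ i)) (M zero (suc i)) q (minor M (inject₁ i)) (minor M (suc i))
  other : ∀ j → j ≢ inject₁ i → j ≢ suc i →
          sign j * E zero j * minor E j ≡ - (sign j * M zero j * minor M j)
  other j p r with euclid-punchIn i j p r
  ... | i′ , h = trans
    (cong₂ (λ a b → sign j * a * b) (euclid-off i q (M zero) p r)
      (trans (det-cong (suc n) (λ r c → h q (M (suc r)) c))
             (det-euclid n i′ q (λ r c → M (suc r) (punchIn j c)))))
    (sym (ℤ.neg-distribʳ-* (sign j * M zero j) _))

-- Clearing a row by Euclidean steps

run : List (Fin n × ℤ) → (Fin (suc n) → ℤ) → Fin (suc n) → ℤ
run []            a = a
run ((i , q) ∷ l) a = run l (euclid i q a)

run-++ : ∀ (l l′ : List (Fin n × ℤ)) a j → run (l ++ l′) a j ≡ run l′ (run l a) j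
run-++ []            l′ a j = refl
run-++ ((i , q) ∷ l) l′ a j = run-++ l l′ (euclid i q a) j

shift : List (Fin n × ℤ) → List (Fin (suc n) × ℤ)
shift = map (map₁ suc)

run-shift : ∀ (l : List (Fin n × ℤ)) a j → run (shift l) a (suc j) ≡ run l (a ∘ suc) j
run-shift []            a j = refl
run-shift ((i , q) ∷ l) a j = run-shift l (euclid (suc i) q a) j

euclid-terminates : ∀ b (a : Fin (suc (suc n)) → ℤ) → ∣ a (suc zero) ∣ ℕ.< b →
                    (∀ j → a (suc (suc j)) ≡ 0ℤ) → ∃[ l ] (∀ j → run l a (suc j) ≡ 0ℤ)
euclid-terminates (suc b) a lt h with a (suc zero) ℤ.≟ 0ℤ
... | yes e = [] , λ where
  zero    → e
  (suc j) → h j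
... | no ne = let l , z = euclid-terminates b a′ smaller h in (zero , q) ∷ l , z
  where
  instance _ = ℤ.≢-nonZero ne
  -- With the Euclidean quotient, the new second entry is the remainder, which is smaller in
  -- absolute value than the divisor, so the bound `b` drops.
  q = a zero ℤ./ a (suc zero)
  a′ = euclid zero q a
  remainder : a′ (suc zero) ≡ + (a zero ℤ.% a (suc zero))
  remainder = trans (cong (λ t → t - q * a (suc zero)) (ℤ.a≡a%n+[a/n]*n (a zero) (a (suc zero))))
                    (i+j-j≡i (+ (a zero ℤ.% a (suc zero))) (q * a (suc zero)))
  smaller : ∣ a′ (suc zero) ∣ ℕ.< b
  smaller = subst (λ t → ∣ t ∣ ℕ.< b) (sym remainder)
              (ℕ.<-≤-trans (ℤ.n%d<d (a zero) (a (suc zero))) (ℕ.s≤s⁻¹ lt))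

-- Clearing the tail first leaves nonzero entries in the two front positions only, where the
-- Euclidean algorithm applies.
eliminate : ∀ n (a : Fin (suc n) → ℤ) → ∃[ l ] (∀ j → run {n} l a (suc j) ≡ 0ℤ)
eliminate zero    a = [] , λ ()
eliminate (suc n) a =
  let l  , z  = eliminate n (a ∘ suc)
      a′      = run (shift l) a
      l′ , z′ = euclid-terminates (suc ∣ a′ (suc zero) ∣) a′ (ℕ.n<1+n _)
                  (λ j → trans (run-shift l a (suc j)) (z j))
  in shift l ++ l′ , λ j → trans (run-++ (shift l) l′ a (suc j)) (z′ j)

det-run : ∀ (l : List (Fin n × ℤ)) (M : Matrix (suc n)) →
          ∣ det (suc n) (λ r → run l (M r)) ∣ ≡ ∣ det (suc n) M ∣
det-run []            M = refl
det-run {n} ((i , q) ∷ l) M = trans (det-run l (λ r → euclid i q (M r)))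
  (trans (cong ∣_∣ (det-euclid n i q M)) (ℤ.∣-i∣≡∣i∣ (det (suc n) M)))

-- Cokernels

app : (Fin m → Fin n → ℤ) → (Fin n → ℤ) → Fin m → ℤ
app {n = n} A x w = Σℤ n (λ v → x v * A w v)

dot : (Fin n → ℤ) → (Fin n → ℤ) → ℤ
dot {n} y z = Σℤ n (λ r → y r * z r)

-- The pattern of `PicCard` with carrier, relation and index type as parameters, so that cokernels,
-- their degree zero variants and Pic⁰ share one notion of counting. A general index type admits
-- pairs, which `Enum-×` flattens.
record Enum {X : Set} (C : X → Set) (_~_ : X → X → Set) (I : Set) : Set where
  constructor enum
  field
    rep        : I → X
    rep-in     : ∀ i → C (rep i)
    injective  : ∀ i j → rep i ~ rep j → i ≡ j
    surjective : ∀ D → C D → ∃[ i ] D ~ rep i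

Enum-resp : ∀ {X I} {C : X → Set} {R S : X → X → Set} →
            (∀ {D E} → R D E → S D E) → (∀ {D E} → S D E → R D E) → Enum C R I → Enum C S I
Enum-resp to from (enum f c inj surj) =
  enum f c (λ i j s → inj i j (from s)) λ D d → let i , r = surj D d in i , to r

Enum-× : ∀ {X} {C : X → Set} {R : X → X → Set} {a b} →
         Enum C R (Fin a × Fin b) → Enum C R (Fin (a ℕ.* b))
Enum-× {R = R} {a} {b} (enum f c inj surj) = enum (f ∘ remQuot b) (c ∘ remQuot b)
  (λ i j r → trans (sym (Fin.combine-remQuot {a} b i))
    (trans (cong (λ p → combine (proj₁ p) (proj₂ p)) (inj _ _ r)) (Fin.combine-remQuot {a} b j)))
  λ D d → let (i , j) , r = surj D d in
    combine i j , subst (λ p → R D (f p)) (sym (Fin.remQuot-combine i j)) r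

-- Matching each representative of the first enumeration with its class in the second is an
-- injection of index sets.
Enum-≤ : ∀ {X} {C : X → Set} {R : X → X → Set} {a b} →
         (∀ {D E} → R D E → R E D) → (∀ {D E F} → R D E → R E F → R D F) →
         Enum C R (Fin a) → Enum C R (Fin b) → a ℕ.≤ b
Enum-≤ {R = R} R-sym R-trans (enum f c inj _) (enum g _ _ surj) =
  Fin.injective⇒≤ {f = λ i → proj₁ (surj (f i) (c i))} λ {i} {j} e →
    inj i j (R-trans (proj₂ (surj (f i) (c i)))
      (R-sym (subst (λ t → R (f j) (g t)) (sym e) (proj₂ (surj (f j) (c j))))))

Enum-unique : ∀ {X} {C : X → Set} {R : X → X → Set} {a b} →
              (∀ {D E} → R D E → R E D) → (∀ {D E F} → R D E → R E F → R D F) →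
              Enum C R (Fin a) → Enum C R (Fin b) → a ≡ b
Enum-unique s t e e′ = ℕ.≤-antisym (Enum-≤ s t e e′) (Enum-≤ s t e′ e)

Mod : Matrix n → Div n → Div n → Set
Mod {n} M D E = Σ[ x ∈ Div n ] (∀ w → D w - E w ≡ app M x w)

CokCard : Matrix n → ℕ → Set
CokCard M N = Enum (λ _ → ⊤) (Mod M) (Fin N)

app-cong : ∀ {A B : Fin m → Fin n → ℤ} → (∀ w v → A w v ≡ B w v) → ∀ x w → app A x w ≡ app B x w
app-cong h x w = Σ-cong (λ v → cong (x v *_) (h w v))

app-congʳ : ∀ (A : Fin m → Fin n → ℤ) {x y} → (∀ v → x v ≡ y v) → ∀ w → app A x w ≡ app A y w
app-congʳ A h w = Σ-cong (λ v → cong (_* A w v) (h v))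

app-+ : ∀ (A : Fin m → Fin n → ℤ) x y w → app A (λ v → x v + y v) w ≡ app A x w + app A y w
app-+ A x y w = trans (Σ-cong (λ v → ℤ.*-distribʳ-+ (A w v) (x v) (y v)))
                      (Σ-+ (λ v → x v * A w v) (λ v → y v * A w v))

app-* : ∀ (A : Fin m → Fin n → ℤ) c x w → app A (λ v → c * x v) w ≡ c * app A x w
app-* A c x w = trans (Σ-cong (λ v → ℤ.*-assoc c (x v) (A w v))) (Σ-*ˡ c (λ v → x v * A w v))

app-neg : ∀ (A : Fin m → Fin n → ℤ) x w → app A (λ v → - x v) w ≡ - app A x w
app-neg A x w = trans (Σ-cong (λ v → sym (ℤ.neg-distribˡ-* (x v) (A w v)))) (Σ-neg (λ v → x v * A w v))

app-- : ∀ (A : Fin m → Fin n → ℤ) x y w → app A (λ v → x v - y v) w ≡ app A x w - app A y w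
app-- A x y w = trans (app-+ A x (λ v → - y v) w) (cong (_+_ (app A x w)) (app-neg A y w))

Mod-sym : ∀ (M : Matrix n) {D E} → Mod M D E → Mod M E D
Mod-sym M {D} {E} (x , h) = (λ v → - x v) , λ w →
  trans (flip (D w) (E w)) (trans (cong -_ (h w)) (sym (app-neg M x w)))
  where
  flip : ∀ d e → e - d ≡ - (d - e)
  flip = solve-∀

Mod-trans : ∀ (M : Matrix n) {D E F} → Mod M D E → Mod M E F → Mod M D F
Mod-trans M {D} {E} {F} (x , h) (y , k) = (λ v → x v + y v) , λ w →
  trans (telescope (D w) (E w) (F w)) (trans (cong₂ _+_ (h w) (k w)) (sym (app-+ M x y w)))
  where
  telescope : ∀ d e f → d - f ≡ (d - e) + (e - f)
  telescope = solve-∀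

Mod-cong : ∀ {M M′ : Matrix n} → (∀ w v → M w v ≡ M′ w v) → ∀ {D E} → Mod M D E → Mod M′ D E
Mod-cong h (x , k) = x , λ w → trans (k w) (app-cong h x w)

CokCard-cong : ∀ {M M′ : Matrix n} {N} → (∀ w v → M w v ≡ M′ w v) → CokCard M N → CokCard M′ N
CokCard-cong h = Enum-resp (λ {D} {E} → Mod-cong h {D} {E}) (λ {D} {E} → Mod-cong (λ w v → sym (h w v)) {D} {E})

CokCard-unique : ∀ (M : Matrix n) {a b} → CokCard M a → CokCard M b → a ≡ b
CokCard-unique M = Enum-unique (λ {D} {E} → Mod-sym M {D} {E}) (λ {D} {E} {F} → Mod-trans M {D} {E} {F})

-- The Euclid step is symmetric for the dot product, so column operations do not change the image.
euclid-adjoint : ∀ (i : Fin n) q x a → dot x (euclid i q a) ≡ dot (euclid i q x) a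
euclid-adjoint {suc n} zero q x a =
  regroup (x zero) (x (suc zero)) (a zero) (a (suc zero)) q (Σℤ n (λ j → x (suc (suc j)) * a (suc (suc j))))
  where
  regroup : ∀ x y a b q s → x * b + (y * (a - q * b) + s) ≡ y * a + ((x - q * y) * b + s)
  regroup = solve-∀
euclid-adjoint (suc i) q x a = cong (_+_ (x zero * a zero)) (euclid-adjoint i q (x ∘ suc) (a ∘ suc))

uneuclid : Fin n → ℤ → (Fin (suc n) → ℤ) → Fin (suc n) → ℤ
uneuclid zero    q a zero          = a (suc zero) + q * a zero
uneuclid zero    q a (suc zero)    = a zero
uneuclid zero    q a (suc (suc j)) = a (suc (suc j))
uneuclid (suc i) q a zero          = a zero
uneuclid (suc i) q a (suc j)       = uneuclid i q (a ∘ suc) j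

euclid-uneuclid : ∀ (i : Fin n) q a j → euclid i q (uneuclid i q a) j ≡ a j
euclid-uneuclid zero    q a zero          = refl
euclid-uneuclid zero    q a (suc zero)    = i+j-j≡i (a (suc zero)) (q * a zero)
euclid-uneuclid zero    q a (suc (suc j)) = refl
euclid-uneuclid (suc i) q a zero          = refl
euclid-uneuclid (suc i) q a (suc j)       = euclid-uneuclid i q (a ∘ suc) j

image-run : ∀ (l : List (Fin n × ℤ)) (M : Matrix (suc n)) x →
            ∃[ y ] (∀ w → app (λ r → run l (M r)) x w ≡ app M y w)
image-run []            M x = x , λ w → refl
image-run ((i , q) ∷ l) M x =
  let y , h = image-run l (λ r → euclid i q (M r)) x
  in euclid i q y , λ w → trans (h w) (euclid-adjoint i q y (M w))

image-run⁻¹ : ∀ (l : List (Fin n × ℤ)) (M : Matrix (suc n)) x →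
              ∃[ y ] (∀ w → app M x w ≡ app (λ r → run l (M r)) y w)
image-run⁻¹ []            M x = x , λ w → refl
image-run⁻¹ ((i , q) ∷ l) M x =
  let y , h = image-run⁻¹ l (λ r → euclid i q (M r)) (uneuclid i q x)
  in y , λ w → trans (app-congʳ M (λ v → sym (euclid-uneuclid i q x v)) w)
                 (trans (sym (euclid-adjoint i q (uneuclid i q x) (M w))) (h w))

-- This form depends on the image alone, so it survives column operations; it passes to the lower
-- right block of a matrix with cleared first row; and for a symmetric matrix it is a statement
-- about the kernel, which is what the maximum principle yields.
Nondegenerate : Matrix n → Set
Nondegenerate M = ∀ y → (∀ x → dot y (app M x) ≡ 0ℤ) → ∀ r → y r ≡ 0ℤ

-- Residues, and the cokernel of a matrix with cleared first row

∣+a-+b∣<c : ∀ {a b c} → a ℕ.< c → b ℕ.< c → ∣ + a - + b ∣ ℕ.< c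
∣+a-+b∣<c {a} {b} {c} p q = ℕ.≤-<-trans
  (subst (λ t → ∣ t ∣ ℕ.≤ a ℕ.⊔ b) (sym (ℤ.[+m]-[+n]≡m⊖n a b)) (ℤ.∣m⊝n∣≤m⊔n a b))
  (ℕ.⊔-lub p q)

multiple-small : ∀ x d → ∣ x * d ∣ ℕ.< ∣ d ∣ → x ≡ 0ℤ
multiple-small x d lt = ℤ.∣i∣≡0⇒i≡0 (small ∣ x ∣ (subst (ℕ._< ∣ d ∣) (ℤ.abs-* x d) lt))
  where
  small : ∀ p → p ℕ.* ∣ d ∣ ℕ.< ∣ d ∣ → p ≡ 0
  small zero    _ = refl
  small (suc p) l = contradiction l (ℕ.≤⇒≯ (ℕ.m≤m+n ∣ d ∣ (p ℕ.* ∣ d ∣)))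

residue-unique : ∀ {d} (r s : Fin ∣ d ∣) x → + toℕ r - + toℕ s ≡ x * d → r ≡ s × x ≡ 0ℤ
residue-unique {d} r s x e = r≡s , x≡0
  where
  x≡0 : x ≡ 0ℤ
  x≡0 = multiple-small x d (subst (λ t → ∣ t ∣ ℕ.< ∣ d ∣) e (∣+a-+b∣<c (Fin.toℕ<n r) (Fin.toℕ<n s)))
  r≡s : r ≡ s
  r≡s = Fin.toℕ-injective (ℤ.+-injective (ℤ.i-j≡0⇒i≡j _ _
          (trans e (cong (_* d) x≡0))))

residue : ∀ a d → d ≢ 0ℤ → Σ[ r ∈ Fin ∣ d ∣ ] Σ[ q ∈ ℤ ] (a ≡ + toℕ r + q * d)
residue a d d≢0 = fromℕ< lt , a ℤ./ d ,
  trans (ℤ.a≡a%n+[a/n]*n a d) (cong (λ t → + t + a ℤ./ d * d) (sym (Fin.toℕ-fromℕ< lt)))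
  where
  instance _ = ℤ.≢-nonZero d≢0
  lt = ℤ.n%d<d a d

module Triangular (M : Matrix (suc n)) (row : ∀ j → M zero (suc j) ≡ 0ℤ) where

  d : ℤ
  d = M zero zero

  M′ : Matrix n
  M′ r c = M (suc r) (suc c)

  app-zero : ∀ x → app M x zero ≡ x zero * d
  app-zero x = trans (cong (_+_ (x zero * d))
    (Σ-vanish (λ j → trans (cong (x (suc j) *_) (row j)) (ℤ.*-zeroʳ (x (suc j)))))) (ℤ.+-identityʳ _)

  det-triangular : det (suc n) M ≡ d * det n M′
  det-triangular = trans (cong₂ _+_ (cong (_* det n M′) (ℤ.*-identityˡ d)) (Σ-vanish vanish)) (ℤ.+-identityʳ _)
    where
    vanish : ∀ j → sign (suc j) * M zero (suc j) * det n (λ r c → M (suc r) (punchIn (suc j) c)) ≡ 0ℤ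
    vanish j = trans (cong (λ t → sign (suc j) * t * det n (λ r c → M (suc r) (punchIn (suc j) c))) (row j))
                     (cong (_* det n (λ r c → M (suc r) (punchIn (suc j) c))) (ℤ.*-zeroʳ (sign (suc j))))

  -- If the pivot vanished, the whole first row would, and the first coordinate would be a covector
  -- annihilating the image.
  pivot≢0 : Nondegenerate M → d ≢ 0ℤ
  pivot≢0 nd d≡0 with nd (δ zero) (λ x → trans (Σ-cong (λ r → ℤ.*-comm (δ zero r) (app M x r)))
      (trans (Σ-δ (app M x) zero) (trans (app-zero x) (trans (cong (x zero *_) d≡0) (ℤ.*-zeroʳ (x zero)))))) zero
  ... | ()

  nondegenerate′ : Nondegenerate M → Nondegenerate M′
  nondegenerate′ nd y kills r =
    [ (λ d≡0 → contradiction d≡0 (pivot≢0 nd)) , id ]′ (ℤ.i*j≡0⇒i≡0∨j≡0 d (nd y⁺ kills⁺ (suc r)))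
    where
    c : Fin n → ℤ
    c r = M (suc r) zero
    -- Extension of `y` to a covector for `M`: the first entry has to cancel the contribution of the
    -- first column, and scaling by `d` avoids dividing by the pivot.
    y⁺ : Fin (suc n) → ℤ
    y⁺ zero    = - dot y c
    y⁺ (suc r) = d * y r
    expand : ∀ d y x c a → d * y * (x * c + a) ≡ d * x * (y * c) + d * (y * a)
    expand = solve-∀
    cancel : ∀ p x d z → z ≡ 0ℤ → - p * (x * d) + (d * x * p + d * z) ≡ 0ℤ
    cancel p x d .0ℤ refl = cancel′ p x d
      where
      cancel′ : ∀ p x d → - p * (x * d) + (d * x * p + d * 0ℤ) ≡ 0ℤ
      cancel′ = solve-∀
    kills⁺ : ∀ x → dot y⁺ (app M x) ≡ 0ℤ
    kills⁺ x = begin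
      - dot y c * app M x zero + Σℤ n (λ r → d * y r * (x zero * c r + app M′ (x ∘ suc) r))
        ≡⟨ cong₂ _+_ (cong (- dot y c *_) (app-zero x))
             (trans (Σ-cong (λ r → expand d (y r) (x zero) (c r) (app M′ (x ∘ suc) r)))
                    (trans (Σ-+ (λ r → d * x zero * (y r * c r)) (λ r → d * (y r * app M′ (x ∘ suc) r)))
                      (cong₂ _+_ (Σ-*ˡ (d * x zero) (λ r → y r * c r))
                                 (Σ-*ˡ d (λ r → y r * app M′ (x ∘ suc) r))))) ⟩
      - dot y c * (x zero * d) + (d * x zero * dot y c + d * dot y (app M′ (x ∘ suc)))
        ≡⟨ cancel (dot y c) (x zero) d (dot y (app M′ (x ∘ suc))) (kills (x ∘ suc)) ⟩
      0ℤ ∎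
      where open ≡-Reasoning

  -- The first coordinate of a class is determined modulo `d`. Equal residues force the first
  -- coordinate of the witness to vanish, so the other coordinates are compared modulo `M′` alone.
  cokCard : d ≢ 0ℤ → ∀ {N} → CokCard M′ N → CokCard M (∣ d ∣ ℕ.* N)
  cokCard d≢0 {N} (enum f _ inj surj) = Enum-× (enum g (λ _ → tt) g-inj λ D _ → g-surj D)
    where
    g : Fin ∣ d ∣ × Fin N → Div (suc n)
    g (r , i) zero    = + toℕ r
    g (r , i) (suc w) = f i w
    g-inj : ∀ p q → Mod M (g p) (g q) → p ≡ q
    g-inj (r , i) (s , j) (x , h) =
      let r≡s , x₀≡0 = residue-unique {d} r s (x zero) (trans (h zero) (app-zero x))
      in cong₂ _,_ r≡s (inj i j (x ∘ suc , λ w → trans (h (suc w))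
           (trans (cong (λ t → t * M (suc w) zero + app M′ (x ∘ suc) w) x₀≡0) (ℤ.+-identityˡ _))))
    g-surj : ∀ D → ∃[ p ] Mod M D (g p)
    g-surj D with residue (D zero) d d≢0
    -- Reducing the first coordinate costs `q` times the first column, which has to be taken off the
    -- other coordinates too.
    ... | r , q , e with surj (λ w → D (suc w) - q * M (suc w) zero) tt
    ...   | i , x , h = (r , i) , x⁺ , eq
      where
      x⁺ : Div (suc n)
      x⁺ zero    = q
      x⁺ (suc v) = x v
      cancel : ∀ r p → r + p - r ≡ p
      cancel = solve-∀
      move : ∀ a b c → a - c ≡ b + (a - b - c)
      move = solve-∀
      eq : ∀ w → D w - g (r , i) w ≡ app M x⁺ w
      eq zero    = trans (cong (_- + toℕ r) e) (trans (cancel (+ toℕ r) (q * d)) (sym (app-zero x⁺)))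
      eq (suc w) = trans (move (D (suc w)) (q * M (suc w) zero) (f i w)) (cong (_+_ (q * M (suc w) zero)) (h w))

-- Clearing the first row changes neither the image nor the absolute value of the determinant;
-- afterwards both the order and the determinant split off the pivot.
cokCard-det : ∀ n (M : Matrix n) → Nondegenerate M → CokCard M ∣ det n M ∣
cokCard-det zero    M nd = enum (λ _ ()) (λ _ → tt) (λ { zero zero _ → refl }) λ D _ → zero , (λ ()) , λ ()
cokCard-det (suc n) M nd = subst (CokCard M) size
  (Enum-resp (λ (x , h) → let y , k = image-run l M x in y , λ w → trans (h w) (k w))
             (λ (x , h) → let y , k = image-run⁻¹ l M x in y , λ w → trans (h w) (k w))
             (T.cokCard (T.pivot≢0 nd′) (cokCard-det n T.M′ (T.nondegenerate′ nd′))))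
  where
  l : List (Fin n × ℤ)
  l = proj₁ (eliminate n (M zero))
  M⁺ : Matrix (suc n)
  M⁺ r = run l (M r)
  module T = Triangular M⁺ (proj₂ (eliminate n (M zero)))
  nd′ : Nondegenerate M⁺
  nd′ y kills = nd y λ x → let z , k = image-run⁻¹ l M x in
    trans (Σ-cong (λ r → cong (y r *_) (k r))) (kills z)
  size : ∣ T.d ∣ ℕ.* ∣ det n T.M′ ∣ ≡ ∣ det (suc n) M ∣
  size = trans (sym (ℤ.abs-* T.d (det n T.M′)))
    (trans (cong ∣_∣ (sym T.det-triangular)) (det-run l M))

-- Nonnegative sums, extremal entries and symmetric pairings

Σ-nonneg : ∀ {n} {f : Fin n → ℤ} → (∀ i → 0ℤ ℤ.≤ f i) → 0ℤ ℤ.≤ Σℤ n f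
Σ-nonneg {zero}  h = ℤ.≤-refl
Σ-nonneg {suc n} h = ℤ.+-mono-≤ (h zero) (Σ-nonneg (h ∘ suc))

Σ-nonneg-vanish : ∀ {n} {f : Fin n → ℤ} → (∀ i → 0ℤ ℤ.≤ f i) → Σℤ n f ℤ.≤ 0ℤ → ∀ i → f i ≡ 0ℤ
Σ-nonneg-vanish {suc n} {f} h le zero = ℤ.≤-antisym
  (ℤ.≤-trans (subst (ℤ._≤ Σℤ (suc n) f) (ℤ.+-identityʳ (f zero))
     (ℤ.+-monoʳ-≤ (f zero) (Σ-nonneg (h ∘ suc)))) le) (h zero)
Σ-nonneg-vanish {suc n} {f} h le (suc i) = Σ-nonneg-vanish (h ∘ suc)
  (ℤ.≤-trans (subst (ℤ._≤ Σℤ (suc n) f) (ℤ.+-identityˡ _)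
     (ℤ.+-monoˡ-≤ (Σℤ n (f ∘ suc)) (h zero))) le) i

Σ-const : ∀ n c → Σℤ n (λ _ → c) ≡ + n * c
Σ-const zero    c = refl
Σ-const (suc n) c = trans (cong (_+_ c) (Σ-const n c)) (sym (ℤ.suc-* (+ n) c))

argmax : ∀ {n} (f : Fin (suc n) → ℤ) → ∃[ i ] (∀ j → f j ℤ.≤ f i)
argmax {zero}  f = zero , λ { zero → ℤ.≤-refl }
argmax {suc n} f with argmax (f ∘ suc)
... | i , h with ℤ.≤-total (f zero) (f (suc i))
...   | inj₁ le = suc i , λ { zero → le ; (suc j) → h j }
...   | inj₂ ge = zero , λ { zero → ℤ.≤-refl ; (suc j) → ℤ.≤-trans (h j) ge }

argmin : ∀ {n} (f : Fin (suc n) → ℤ) → ∃[ i ] (∀ j → f i ℤ.≤ f j)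
argmin f with argmax (λ i → - f i)
... | i , h = i , λ j → ℤ.neg-cancel-≤ (h j)

deg-δ : ∀ (i : Fin n) → deg (δ i) ≡ 1ℤ
deg-δ i = trans (Σ-cong (λ j → sym (ℤ.*-identityˡ (δ i j)))) (Σ-δ (λ _ → 1ℤ) i)

dot-app-sym : ∀ (A : Matrix n) → (∀ u v → A u v ≡ A v u) → ∀ x y → dot y (app A x) ≡ dot (app A y) x
dot-app-sym {n} A A-sym x y = begin
  Σℤ n (λ w → y w * Σℤ n (λ v → x v * A w v))   ≡⟨ Σ-cong (λ w → sym (Σ-*ˡ (y w) (λ v → x v * A w v))) ⟩
  Σℤ n (λ w → Σℤ n (λ v → y w * (x v * A w v))) ≡⟨ Σ-swap (λ w v → y w * (x v * A w v)) ⟩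
  Σℤ n (λ v → Σℤ n (λ w → y w * (x v * A w v)))
    ≡⟨ Σ-cong (λ v → Σ-cong (λ w → trans (cong (λ t → y w * (x v * t)) (A-sym w v)) (rot (y w) (x v) (A v w)))) ⟩
  Σℤ n (λ v → Σℤ n (λ w → y w * A v w * x v))   ≡⟨ Σ-cong (λ v → Σ-*ʳ (x v) (λ w → y w * A v w)) ⟩
  Σℤ n (λ v → Σℤ n (λ w → y w * A v w) * x v)   ∎
  where
  open ≡-Reasoning
  rot : ∀ y x a → y * (x * a) ≡ y * a * x
  rot = solve-∀

-- The Laplacian

lap-δ : ∀ (G : Graph n) w v → lap G w v ≡ δ w v * degree G v - b2ℤ (adj G w v)
lap-δ G w v with w ≟ v
... | yes refl rewrite irrefl G w | δ-refl w = sym (trans (ℤ.+-identityʳ _) (ℤ.*-identityˡ (degree G w)))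
... | no w≢v rewrite δ-≢ w≢v = sym (ℤ.+-identityˡ (- b2ℤ (adj G w v)))

lap-sym : ∀ (G : Graph n) w v → lap G w v ≡ lap G v w
lap-sym G w v = trans (lap-δ G w v) (trans (cong₂ _-_ diag (cong b2ℤ (Graph.sym G w v))) (sym (lap-δ G v w)))
  where
  diag : δ w v * degree G v ≡ δ v w * degree G w
  diag with w ≟ v
  ... | yes refl = refl
  ... | no w≢v rewrite δ-≢ w≢v | δ-≢ (w≢v ∘ sym) = refl

-- In this form constants are visibly in the kernel, and at an extremum of `x` all summands have the
-- same sign.
lap-differences : ∀ (G : Graph n) x w → app (lap G) x w ≡ Σℤ n (λ v → b2ℤ (adj G w v) * (x w - x v))
lap-differences {n} G x w = begin
  Σℤ n (λ v → x v * lap G w v)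
    ≡⟨ Σ-cong (λ v → trans (cong (x v *_) (trans (lap-sym G w v) (trans (lap-δ G v w)
         (cong (λ b → δ v w * degree G w - b2ℤ b) (Graph.sym G v w)))))
         (trans (cong (λ t → x v * (t * degree G w - a v)) (δ-sym v w)) (split (x v) (δ w v) (degree G w) (a v)))) ⟩
  Σℤ n (λ v → x v * δ w v * degree G w - a v * x v)
    ≡⟨ Σ-- (λ v → x v * δ w v * degree G w) (λ v → a v * x v) ⟩
  Σℤ n (λ v → x v * δ w v * degree G w) - Σℤ n (λ v → a v * x v)
    ≡⟨ cong (_- Σℤ n (λ v → a v * x v)) (trans (Σ-*ʳ (degree G w) (λ v → x v * δ w v))
         (trans (cong (_* degree G w) (Σ-δ x w)) (trans (ℤ.*-comm (x w) (degree G w)) (sym (Σ-*ʳ (x w) a))))) ⟩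
  Σℤ n (λ v → a v * x w) - Σℤ n (λ v → a v * x v)
    ≡⟨ Σ-- (λ v → a v * x w) (λ v → a v * x v) ⟨
  Σℤ n (λ v → a v * x w - a v * x v)
    ≡⟨ Σ-cong (λ v → factor (a v) (x w) (x v)) ⟩
  Σℤ n (λ v → a v * (x w - x v)) ∎
  where
  open ≡-Reasoning
  a : Fin n → ℤ
  a v = b2ℤ (adj G w v)
  split : ∀ x e d b → x * (e * d - b) ≡ x * e * d - b * x
  split = solve-∀
  factor : ∀ a p q → a * p - a * q ≡ a * (p - q)
  factor = solve-∀

lap-constant : ∀ (G : Graph n) {x} → (∀ u v → x u ≡ x v) → ∀ w → app (lap G) x w ≡ 0ℤ
lap-constant G {x} h w = trans (lap-differences G x w)
  (Σ-vanish (λ v → trans (cong (b2ℤ (adj G w v) *_) (ℤ.i≡j⇒i-j≡0 (h w v))) (ℤ.*-zeroʳ (b2ℤ (adj G w v)))))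

-- The degree is the pairing with the constant 1, and the symmetric Laplacian kills constants.
deg-lap : ∀ (G : Graph n) x → deg (app (lap G) x) ≡ 0ℤ
deg-lap G x = begin
  deg (app (lap G) x)           ≡⟨ Σ-cong (λ w → sym (ℤ.*-identityˡ (app (lap G) x w))) ⟩
  dot (λ _ → 1ℤ) (app (lap G) x) ≡⟨ dot-app-sym (lap G) (lap-sym G) x (λ _ → 1ℤ) ⟩
  dot (app (lap G) (λ _ → 1ℤ)) x ≡⟨ Σ-vanish (λ w → cong (_* x w) (lap-constant G {λ _ → 1ℤ} (λ _ _ → refl) w)) ⟩
  0ℤ ∎
  where open ≡-Reasoning

b2ℤ-*-nonneg : ∀ b {z} → 0ℤ ℤ.≤ z → 0ℤ ℤ.≤ b2ℤ b * z
b2ℤ-*-nonneg true  {z} h = subst (0ℤ ℤ.≤_) (sym (ℤ.*-identityˡ z)) h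
b2ℤ-*-nonneg false     h = ℤ.≤-refl

-- Maximum principle: at a maximum v and a minimum w of y we have (L y) v ≥ 0 ≥ (L y) w, so
-- constancy of L y + s y forces (L y) v = 0, and y takes its maximum at all neighbours of v.
maximum-principle : ∀ (G : Graph n) → Connected G → ∀ s → 0ℤ ℤ.≤ s → ∀ y c →
                    (∀ w → app (lap G) y w + s * y w ≡ c) → ∀ u v → y u ≡ y v
maximum-principle {suc n} G conn s s≥0 y c h u v =
  trans (spread (conn top u) refl) (sym (spread (conn top v) refl))
  where
  instance _ = ℤ.nonNegative s≥0
  top = proj₁ (argmax y)
  ≤top = proj₂ (argmax y)
  bot = proj₁ (argmin y)
  bot≤ = proj₂ (argmin y)
  swap : ∀ a p q → a * (p - q) ≡ - (a * (q - p))
  swap = solve-∀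
  bot-nonpos : app (lap G) y bot ℤ.≤ 0ℤ
  bot-nonpos = subst (ℤ._≤ 0ℤ)
    (sym (trans (lap-differences G y bot) (trans (Σ-cong (λ v → swap (b2ℤ (adj G bot v)) (y bot) (y v)))
       (Σ-neg (λ v → b2ℤ (adj G bot v) * (y v - y bot))))))
    (ℤ.neg-mono-≤ (Σ-nonneg (λ v → b2ℤ-*-nonneg (adj G bot v) (ℤ.i≤j⇒0≤j-i (bot≤ v)))))
  at-max-nonpos : ∀ {v} → y v ≡ y top → app (lap G) y v ℤ.≤ 0ℤ
  at-max-nonpos {v} e = begin
    app (lap G) y v                           ≡⟨ i+j-j≡i _ (s * y v) ⟨
    app (lap G) y v + s * y v - s * y v       ≡⟨ cong (_- s * y v) (trans (h v) (sym (h bot))) ⟩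
    app (lap G) y bot + s * y bot - s * y v   ≤⟨ ℤ.+-monoˡ-≤ (- (s * y v)) (ℤ.+-mono-≤ bot-nonpos (ℤ.*-monoˡ-≤-nonNeg s (bot≤ v))) ⟩
    0ℤ + s * y v - s * y v                    ≡⟨ i+j-j≡i 0ℤ (s * y v) ⟩
    0ℤ ∎
    where open ℤ.≤-Reasoning
  neighbour : ∀ {v w} → y v ≡ y top → adj G v w ≡ true → y w ≡ y top
  neighbour {v} {w} e vw = trans (sym (ℤ.i-j≡0⇒i≡j (y v) (y w) difference)) e
    where
    difference : y v - y w ≡ 0ℤ
    difference = trans (sym (ℤ.*-identityˡ (y v - y w))) (trans (cong (λ b → b2ℤ b * (y v - y w)) (sym vw))
      (Σ-nonneg-vanish
        (λ u → b2ℤ-*-nonneg (adj G v u) (ℤ.i≤j⇒0≤j-i (subst (y u ℤ.≤_) (sym e) (≤top u))))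
        (subst (ℤ._≤ 0ℤ) (lap-differences G y v) (at-max-nonpos e)) w))
  spread : ∀ {v w} → Reach G v w → y v ≡ y top → y w ≡ y top
  spread here         e = e
  spread (step vw r)  e = spread r (neighbour e vw)

-- Coordinates on divisors of degree zero

ext : (Fin m → ℤ) → ℤ → Fin (suc m) → ℤ
ext {zero}  x a zero    = a
ext {suc m} x a zero    = x zero
ext {suc m} x a (suc w) = ext (x ∘ suc) a w

ext-inject₁ : ∀ (x : Fin m → ℤ) a j → ext x a (inject₁ j) ≡ x j
ext-inject₁ x a zero    = refl
ext-inject₁ x a (suc j) = ext-inject₁ (x ∘ suc) a j

ext-last : ∀ (x : Fin m → ℤ) a → ext x a (fromℕ m) ≡ a
ext-last {zero}  x a = refl
ext-last {suc m} x a = ext-last (x ∘ suc) a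

last-elim : (P : Fin (suc m) → Set) → (∀ j → P (inject₁ j)) → P (fromℕ m) → ∀ w → P w
last-elim {zero}  P i l zero    = l
last-elim {suc m} P i l zero    = i zero
last-elim {suc m} P i l (suc w) = last-elim (P ∘ suc) (i ∘ suc) l w

-- Reduces identities of divisors to the coordinates seen by `lapDiv0` and by the reduced Laplacian;
-- the degree settles the last one.
deg-determines : ∀ {D E : Div (suc m)} → deg D ≡ deg E → (∀ j → D (inject₁ j) ≡ E (inject₁ j)) → ∀ w → D w ≡ E w
deg-determines {m} {D} {E} d h = last-elim (λ w → D w ≡ E w) h (∙-cancelˡ ℤ.+-0-abelianGroup (Σℤ m (D ∘ inject₁)) (D (fromℕ m)) (E (fromℕ m))
  (trans (sym (Σ-last D)) (trans d (trans (Σ-last E) (cong (_+ E (fromℕ m)) (sym (Σ-cong h)))))))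

-- The divisor with coordinates `x` in the basis v_i - v_last that underlies `lapDiv0`.
close : (Fin m → ℤ) → Div (suc m)
close {m} x = ext x (- Σℤ m x)

deg-close : ∀ (x : Fin m → ℤ) → deg (close x) ≡ 0ℤ
deg-close {m} x = trans (Σ-last (close x))
  (trans (cong₂ _+_ (Σ-cong (ext-inject₁ x (- Σℤ m x))) (ext-last x (- Σℤ m x))) (ℤ.+-inverseʳ (Σℤ m x)))

close-inject₁ : ∀ (x : Fin m → ℤ) j → close x (inject₁ j) ≡ x j
close-inject₁ {m} x = ext-inject₁ x (- Σℤ m x)

close-restrict : ∀ {D : Div (suc m)} → deg D ≡ 0ℤ → ∀ w → close (D ∘ inject₁) w ≡ D w
close-restrict {D = D} d = deg-determines (trans (deg-close (D ∘ inject₁)) (sym d)) (close-inject₁ (D ∘ inject₁))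

-- The transpose of `close` takes differences with the last entry, which is how `lapDiv0` is formed
-- from the rows of the Laplacian.
dot-close : ∀ (z : Div (suc m)) x → dot z (close x) ≡ dot (λ j → z (inject₁ j) - z (fromℕ m)) x
dot-close {m} z x = begin
  dot z (close x)
    ≡⟨ Σ-last (λ w → z w * close x w) ⟩
  Σℤ m (λ j → z (inject₁ j) * close x (inject₁ j)) + z (fromℕ m) * close x (fromℕ m)
    ≡⟨ cong₂ _+_ (Σ-cong (λ j → cong (z (inject₁ j) *_) (close-inject₁ x j)))
         (trans (cong (z (fromℕ m) *_) (ext-last x (- Σℤ m x)))
           (trans (sym (ℤ.neg-distribʳ-* (z (fromℕ m)) (Σℤ m x))) (cong -_ (sym (Σ-*ˡ (z (fromℕ m)) x))))) ⟩
  Σℤ m (λ j → z (inject₁ j) * x j) - Σℤ m (λ j → z (fromℕ m) * x j)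
    ≡⟨ Σ-- (λ j → z (inject₁ j) * x j) (λ j → z (fromℕ m) * x j) ⟨
  Σℤ m (λ j → z (inject₁ j) * x j - z (fromℕ m) * x j)
    ≡⟨ Σ-cong (λ j → factor (z (inject₁ j)) (z (fromℕ m)) (x j)) ⟩
  dot (λ j → z (inject₁ j) - z (fromℕ m)) x ∎
  where
  open ≡-Reasoning
  factor : ∀ a b x → a * x - b * x ≡ (a - b) * x
  factor = solve-∀

dot-ext-0 : ∀ (y : Fin m → ℤ) (z : Div (suc m)) → dot (ext y 0ℤ) z ≡ dot y (z ∘ inject₁)
dot-ext-0 {m} y z = trans (Σ-last (λ w → ext y 0ℤ w * z w))
  (trans (cong₂ _+_ (Σ-cong (λ j → cong (_* z (inject₁ j)) (ext-inject₁ y 0ℤ j))) (cong (_* z (fromℕ m)) (ext-last y 0ℤ)))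
         (ℤ.+-identityʳ _))

dot-comm : ∀ (x y : Fin n → ℤ) → dot x y ≡ dot y x
dot-comm x y = Σ-cong (λ i → ℤ.*-comm (x i) (y i))

ext-0-constant : ∀ (y : Fin m → ℤ) → (∀ u v → ext y 0ℤ u ≡ ext y 0ℤ v) → ∀ j → y j ≡ 0ℤ
ext-0-constant {m} y h j = trans (sym (ext-inject₁ y 0ℤ j)) (trans (h (inject₁ j) (fromℕ m)) (ext-last y 0ℤ))

-- Congruence modulo the image of Div⁰

Mod₀ : Matrix n → Div n → Div n → Set
Mod₀ {n} M D E = Σ[ x ∈ Div n ] (deg x ≡ 0ℤ × (∀ w → D w - E w ≡ app M x w))

Degree0 : Div n → Set
Degree0 D = deg D ≡ 0ℤ

Card₀ : Matrix n → ℕ → Set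
Card₀ M N = Enum Degree0 (Mod₀ M) (Fin N)

deg-+* : ∀ (D E : Div n) c → deg (λ w → D w + c * E w) ≡ deg D + c * deg E
deg-+* D E c = trans (Σ-+ D (λ w → c * E w)) (cong (_+_ (deg D)) (Σ-*ˡ c E))

app-+* : ∀ (A : Fin m → Fin n → ℤ) x y c w → app A (λ v → x v + c * y v) w ≡ app A x w + c * app A y w
app-+* A x y c w = trans (app-+ A x (λ v → c * y v) w) (cong (_+_ (app A x w)) (app-* A c y w))

-- If A multiplies degrees by k, the degree identifies coker A / (image of Div⁰) with ℤ/k.
cokCard-from-degree0 : ∀ (A : Matrix (suc m)) k → (∀ x → deg (app A x) ≡ + suc k * deg x) →
                       ∀ {N} → Card₀ A N → CokCard A (suc k ℕ.* N)
cokCard-from-degree0 {m} A k deg-A {N} (enum f f₀ inj surj) =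
  Enum-× (enum g (λ _ → tt) g-inj λ D _ → g-surj D)
  where
  e : Div (suc m)
  e = δ zero
  g : Fin (suc k) × Fin N → Div (suc m)
  g (r , i) w = f i w + + toℕ r * e w
  deg-g : ∀ p → deg (g p) ≡ + toℕ (proj₁ p)
  deg-g (r , i) = trans (deg-+* (f i) e (+ toℕ r)) (trans (cong₂ (λ a b → a + + toℕ r * b) (f₀ i) (deg-δ {suc m} zero))
    (trans (ℤ.+-identityˡ _) (ℤ.*-identityʳ (+ toℕ r))))
  g-inj : ∀ p q → Mod A (g p) (g q) → p ≡ q
  -- Comparing degrees gives r - s = k deg x for the modulus k; besides r = s this yields deg x = 0,
  -- which turns `x` into a witness for `Mod₀`.
  g-inj (r , i) (s , j) (x , h) with residue-unique {+ suc k} r s (deg x)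
    (trans (cong₂ _-_ (sym (deg-g (r , i))) (sym (deg-g (s , j)))) (trans (sym (Σ-- (g (r , i)) (g (s , j))))
      (trans (Σ-cong h) (trans (deg-A x) (ℤ.*-comm (+ suc k) (deg x))))))
  ... | refl , dx = cong (r ,_) (inj i j (x , dx , λ w → trans (cancel (f i w) (f j w) (+ toℕ r * e w)) (h w)))
    where
    cancel : ∀ a b c → a - b ≡ a + c - (b + c)
    cancel = solve-∀
  g-surj : ∀ D → ∃[ p ] Mod A D (g p)
  g-surj D with residue (deg D) (+ suc k) (λ ())
  ... | r , q , eq with surj (λ w → D w - (app A (λ v → q * e v) w + + toℕ r * e w)) deg0
    where
    arith : ∀ r q k → (r + q * k) - (k * (q * 1ℤ) + r * 1ℤ) ≡ 0ℤ
    arith = solve-∀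
    deg0 : deg (λ w → D w - (app A (λ v → q * e v) w + + toℕ r * e w)) ≡ 0ℤ
    deg0 = begin
      deg (λ w → D w - (app A (λ v → q * e v) w + + toℕ r * e w))
        ≡⟨ Σ-- D (λ w → app A (λ v → q * e v) w + + toℕ r * e w) ⟩
      deg D - deg (λ w → app A (λ v → q * e v) w + + toℕ r * e w)
        ≡⟨ cong (_-_ (deg D)) (deg-+* (app A (λ v → q * e v)) e (+ toℕ r)) ⟩
      deg D - (deg (app A (λ v → q * e v)) + + toℕ r * deg e)
        ≡⟨ cong₂ (λ a b → deg D - (a + + toℕ r * b))
             (trans (deg-A (λ v → q * e v)) (cong (+ suc k *_) (trans (Σ-*ˡ q e) (cong (q *_) (deg-δ {suc m} zero)))))
             (deg-δ {suc m} zero) ⟩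
      deg D - (+ suc k * (q * 1ℤ) + + toℕ r * 1ℤ)
        ≡⟨ cong (_- (+ suc k * (q * 1ℤ) + + toℕ r * 1ℤ)) eq ⟩
      (+ toℕ r + q * + suc k) - (+ suc k * (q * 1ℤ) + + toℕ r * 1ℤ)
        ≡⟨ arith (+ toℕ r) q (+ suc k) ⟩
      0ℤ ∎
      where open ≡-Reasoning
  ... | i , x , _ , h = (r , i) , (λ v → x v + q * e v) , λ w →
    trans (move (D w) (app A (λ v → q * e v) w) (+ toℕ r * e w) (f i w))
      (trans (cong (_+ app A (λ v → q * e v) w) (h w)) (sym (app-+ A x (λ v → q * e v) w)))
    where
    move : ∀ d a r f → d - (f + r) ≡ d - (a + r) - f + a
    move = solve-∀

-- The shifted Laplacian

complement : Graph n → Matrix n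
complement G u v = 1ℤ - b2ℤ (adj G u v)

-- For c = complement G this is L + (k - n) I + J, with L the Laplacian and J the all-ones matrix.
shifted : ℤ → Matrix n → Matrix n
shifted {n} k c u v = δ u v * (k - Σℤ n (c v)) + c u v

shifted-complement : ∀ (G : Graph n) k u v → shifted k (complement G) u v ≡ lap G u v + (k - + n) * δ u v + 1ℤ
shifted-complement {n} G k u v = begin
  δ u v * (k - Σℤ n (complement G v)) + (1ℤ - b2ℤ (adj G u v))
    ≡⟨ cong (λ t → δ u v * (k - t) + (1ℤ - b2ℤ (adj G u v)))
         (trans (Σ-- (λ _ → 1ℤ) (λ w → b2ℤ (adj G v w))) (cong (_- degree G v) (trans (Σ-const n 1ℤ) (ℤ.*-identityʳ (+ n))))) ⟩
  δ u v * (k - (+ n - degree G v)) + (1ℤ - b2ℤ (adj G u v))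
    ≡⟨ regroup (δ u v) k (+ n) (degree G v) (b2ℤ (adj G u v)) ⟩
  δ u v * degree G v - b2ℤ (adj G u v) + (k - + n) * δ u v + 1ℤ
    ≡⟨ cong (λ t → t + (k - + n) * δ u v + 1ℤ) (lap-δ G u v) ⟨
  lap G u v + (k - + n) * δ u v + 1ℤ ∎
  where
  open ≡-Reasoning
  regroup : ∀ e k n d a → e * (k - (n - d)) + (1ℤ - a) ≡ e * d - a + (k - n) * e + 1ℤ
  regroup = solve-∀

app-shifted : ∀ (G : Graph n) k x w →
              app (shifted k (complement G)) x w ≡ app (lap G) x w + (k - + n) * x w + deg x
app-shifted {n} G k x w = begin
  app (shifted k (complement G)) x w
    ≡⟨ Σ-cong (λ v → trans (cong (x v *_) (shifted-complement G k w v))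
         (distrib (x v) (lap G w v) (k - + n) (δ w v))) ⟩
  Σℤ n (λ v → x v * lap G w v + (k - + n) * (x v * δ w v) + x v)
    ≡⟨ trans (Σ-+ (λ v → x v * lap G w v + (k - + n) * (x v * δ w v)) x)
         (cong (_+ deg x) (trans (Σ-+ (λ v → x v * lap G w v) (λ v → (k - + n) * (x v * δ w v)))
           (cong (_+_ (app (lap G) x w)) (trans (Σ-*ˡ (k - + n) (λ v → x v * δ w v)) (cong ((k - + n) *_) (Σ-δ x w)))))) ⟩
  app (lap G) x w + (k - + n) * x w + deg x ∎
  where
  open ≡-Reasoning
  distrib : ∀ x l s e → x * (l + s * e + 1ℤ) ≡ x * l + s * (x * e) + x
  distrib = solve-∀

-- The Laplacian contributes nothing, the scalar part (k - n) deg x, and the all-ones matrix n deg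
-- x.
deg-shifted : ∀ (G : Graph n) k x → deg (app (shifted k (complement G)) x) ≡ k * deg x
deg-shifted {n} G k x = begin
  deg (app (shifted k (complement G)) x)
    ≡⟨ Σ-cong (app-shifted G k x) ⟩
  Σℤ n (λ w → app (lap G) x w + (k - + n) * x w + deg x)
    ≡⟨ trans (Σ-+ (λ w → app (lap G) x w + (k - + n) * x w) (λ _ → deg x))
         (cong₂ _+_ (trans (deg-+* (app (lap G) x) x (k - + n)) (cong (_+ (k - + n) * deg x) (deg-lap G x))) (Σ-const n (deg x))) ⟩
  0ℤ + (k - + n) * deg x + + n * deg x
    ≡⟨ collect k (+ n) (deg x) ⟩
  k * deg x ∎
  where
  open ≡-Reasoning
  collect : ∀ k n d → 0ℤ + (k - n) * d + n * d ≡ k * d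
  collect = solve-∀

app-shifted-deg0 : ∀ (G : Graph n) k x → deg x ≡ 0ℤ → ∀ w →
                   app (shifted k (complement G)) x w ≡ app (lap G) x w + (k - + n) * x w
app-shifted-deg0 G k x d w = trans (app-shifted G k x w)
  (trans (cong (_+_ (app (lap G) x w + (k - + _) * x w)) d) (ℤ.+-identityʳ _))

-- Moving `deg x` to the right makes L x + (k - n) x constant, so `x` is constant by the maximum
-- principle. Then L x = 0, and the remaining terms (k - n) x and n x add up to k x.
shifted-solve-constant : ∀ (G : Graph n) → Connected G → ∀ k → 0ℤ ℤ.≤ k - + n → ∀ x t →
                         (∀ w → app (shifted k (complement G)) x w ≡ t) → ∀ w → k * x w ≡ t
shifted-solve-constant {n} G conn k s≥0 x t h w = begin
  k * x w
    ≡⟨ split k (+ n) (x w) ⟩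
  0ℤ + (k - + n) * x w + + n * x w
    ≡⟨ cong₂ (λ a b → a + (k - + n) * x w + b) (sym (lap-constant G {x} const w))
         (trans (sym (Σ-const n (x w))) (Σ-cong (λ v → const w v))) ⟩
  app (lap G) x w + (k - + n) * x w + deg x
    ≡⟨ trans (sym (app-shifted G k x w)) (h w) ⟩
  t ∎
  where
  open ≡-Reasoning
  split : ∀ k n x → k * x ≡ 0ℤ + (k - n) * x + n * x
  split = solve-∀
  const : ∀ u v → x u ≡ x v
  const = maximum-principle G conn (k - + n) s≥0 x (t - deg x)
    (λ w → trans (sym (i+j-j≡i _ (deg x))) (cong (_- deg x) (trans (sym (app-shifted G k x w)) (h w))))

-- The characteristic polynomial as a cokernel order on Div⁰

charMatrix : Graph (suc m) → ℤ → Matrix m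
charMatrix G x i j = x * δ i j - lapDiv0 G i j

-- The left-hand side of charPolyAt-entry mentions a function local to charPolyAt; it is left to be
-- inferred from charPolyAt-det, which is why the two lemmas are mutual.
mutual
  charPolyAt-det : ∀ (G : Graph (suc m)) x → charPolyAt G x ≡ det m (charMatrix G x)
  charPolyAt-det {m} G x = det-cong m (λ i j → charPolyAt-entry G x i j)

  charPolyAt-entry : ∀ (G : Graph (suc m)) x i j → _ ≡ charMatrix G x i j
  charPolyAt-entry G x i j with i ≟ j
  ... | yes refl rewrite δ-refl i = cong (_- lapDiv0 G i i) (sym (ℤ.*-identityʳ x))
  ... | no i≢j rewrite δ-≢ i≢j = cong (_- lapDiv0 G i j) (sym (ℤ.*-zeroʳ x))

app-lapDiv0 : ∀ (G : Graph (suc m)) x j → app (lapDiv0 G) x j ≡ app (lap G) (close x) (inject₁ j)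
app-lapDiv0 G x j = trans (dot-comm x (lapDiv0 G j)) (trans (sym (dot-close (lap G (inject₁ j)) x))
  (dot-comm (lap G (inject₁ j)) (close x)))

app-charMatrix : ∀ (G : Graph (suc m)) k x j →
                 app (charMatrix G (+ suc m - k)) x j ≡ - app (shifted k (complement G)) (close x) (inject₁ j)
app-charMatrix {m} G k x j = begin
  Σℤ m (λ i → x i * ((+ suc m - k) * δ j i - lapDiv0 G j i))
    ≡⟨ Σ-cong (λ i → distrib (x i) (+ suc m - k) (δ j i) (lapDiv0 G j i)) ⟩
  Σℤ m (λ i → (+ suc m - k) * (x i * δ j i) - x i * lapDiv0 G j i)
    ≡⟨ trans (Σ-- (λ i → (+ suc m - k) * (x i * δ j i)) (λ i → x i * lapDiv0 G j i))
         (cong₂ _-_ (trans (Σ-*ˡ (+ suc m - k) (λ i → x i * δ j i))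
           (cong ((+ suc m - k) *_) (trans (Σ-δ x j) (sym (close-inject₁ x j))))) (app-lapDiv0 G x j)) ⟩
  (+ suc m - k) * close x (inject₁ j) - app (lap G) (close x) (inject₁ j)
    ≡⟨ negate (+ suc m) k (close x (inject₁ j)) (app (lap G) (close x) (inject₁ j)) ⟩
  - (app (lap G) (close x) (inject₁ j) + (k - + suc m) * close x (inject₁ j))
    ≡⟨ cong -_ (app-shifted-deg0 G k (close x) (deg-close x) (inject₁ j)) ⟨
  - app (shifted k (complement G)) (close x) (inject₁ j) ∎
  where
  open ≡-Reasoning
  distrib : ∀ x s e l → x * (s * e - l) ≡ s * (x * e) - x * l
  distrib = solve-∀
  negate : ∀ n k c a → (n - k) * c - a ≡ - (a + (k - n) * c)
  negate = solve-∀

module _ (G : Graph (suc m)) (k : ℤ) where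

  private
    T : Matrix (suc m)
    T = shifted k (complement G)
    B : Matrix m
    B = charMatrix G (+ suc m - k)

  shifted-sym : ∀ u v → T u v ≡ T v u
  shifted-sym u v = trans (shifted-complement G k u v)
    (trans (cong₂ (λ a b → a + (k - + suc m) * b + 1ℤ) (lap-sym G u v) (δ-sym u v)) (sym (shifted-complement G k v u)))

  -- Extend `y` by 0 at the last vertex. The extension annihilates T(Div⁰), so by symmetry its image
  -- under T annihilates Div⁰ and is constant. The maximum principle makes the extension constant,
  -- and its last entry is 0.
  charMatrix-nondegenerate : Connected G → 0ℤ ℤ.≤ k - + suc m → Nondegenerate B
  charMatrix-nondegenerate conn s≥0 y kills =
    ext-0-constant y (maximum-principle G conn (k - + suc m) s≥0 ỹ (app T ỹ (fromℕ m) - deg ỹ)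
      (λ w → trans (sym (i+j-j≡i (app (lap G) ỹ w + (k - + suc m) * ỹ w) (deg ỹ)))
        (cong (_- deg ỹ) (trans (sym (app-shifted G k ỹ w)) (last-elim (λ w → app T ỹ w ≡ app T ỹ (fromℕ m)) constant refl w)))))
    where
    ỹ : Div (suc m)
    ỹ = ext y 0ℤ
    constant : ∀ i → app T ỹ (inject₁ i) ≡ app T ỹ (fromℕ m)
    constant i = ℤ.i-j≡0⇒i≡j _ _ (begin
      app T ỹ (inject₁ i) - app T ỹ (fromℕ m)
        ≡⟨ Σ-δ (λ j → app T ỹ (inject₁ j) - app T ỹ (fromℕ m)) i ⟨
      dot (λ j → app T ỹ (inject₁ j) - app T ỹ (fromℕ m)) (δ i)
        ≡⟨ dot-close (app T ỹ) (δ i) ⟨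
      dot (app T ỹ) (close (δ i))
        ≡⟨ dot-app-sym T shifted-sym (close (δ i)) ỹ ⟨
      dot ỹ (app T (close (δ i)))
        ≡⟨ dot-ext-0 y (app T (close (δ i))) ⟩
      dot y (app T (close (δ i)) ∘ inject₁)
        ≡⟨ Σ-cong (λ j → trans (cong (y j *_) (trans (sym (ℤ.neg-involutive _)) (cong -_ (sym (app-charMatrix G k (δ i) j)))))
             (sym (ℤ.neg-distribʳ-* (y j) (app B (δ i) j)))) ⟩
      Σℤ m (λ j → - (y j * app B (δ i) j))
        ≡⟨ trans (Σ-neg (λ j → y j * app B (δ i) j)) (cong -_ (kills (δ i))) ⟩
      0ℤ ∎)
      where open ≡-Reasoning

  shifted-card₀ : ∀ {N} → CokCard B N → Card₀ T N
  shifted-card₀ {N} (enum f _ inj surj) = enum (close ∘ f) (λ i → deg-close (f i)) g-inj g-surj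
    where
    g-inj : ∀ i j → Mod₀ T (close (f i)) (close (f j)) → i ≡ j
    g-inj i j (x , d , h) = inj i j ((λ v → - x (inject₁ v)) , λ w → begin
      f i w - f j w
        ≡⟨ cong₂ _-_ (close-inject₁ (f i) w) (close-inject₁ (f j) w) ⟨
      close (f i) (inject₁ w) - close (f j) (inject₁ w)
        ≡⟨ h (inject₁ w) ⟩
      app T x (inject₁ w)
        ≡⟨ app-congʳ T (close-restrict {D = x} d) (inject₁ w) ⟨
      app T (close (x ∘ inject₁)) (inject₁ w)
        ≡⟨ ℤ.neg-involutive _ ⟨
      - - app T (close (x ∘ inject₁)) (inject₁ w)
        ≡⟨ cong -_ (app-charMatrix G k (x ∘ inject₁) w) ⟨
      - app B (x ∘ inject₁) w
        ≡⟨ app-neg B (x ∘ inject₁) w ⟨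
      app B (λ v → - x (inject₁ v)) w ∎)
      where open ≡-Reasoning
    g-surj : ∀ D → deg D ≡ 0ℤ → ∃[ i ] Mod₀ T D (close (f i))
    g-surj D d with surj (D ∘ inject₁) tt
    ... | i , x , h = i , z , deg-z , deg-determines degrees (λ j → begin
      D (inject₁ j) - close (f i) (inject₁ j)  ≡⟨ cong (_-_ (D (inject₁ j))) (close-inject₁ (f i) j) ⟩
      D (inject₁ j) - f i j                    ≡⟨ h j ⟩
      app B x j                                ≡⟨ app-charMatrix G k x j ⟩
      - app T (close x) (inject₁ j)            ≡⟨ app-neg T (close x) (inject₁ j) ⟨
      app T z (inject₁ j)                      ∎)
      where
      open ≡-Reasoning
      z : Div (suc m)
      z v = - close x v
      deg-z : deg z ≡ 0ℤ
      deg-z = trans (Σ-neg (close x)) (cong -_ (deg-close x))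
      degrees : deg (λ w → D w - close (f i) w) ≡ deg (app T z)
      degrees = trans (trans (Σ-- D (close (f i))) (cong₂ _-_ d (deg-close (f i))))
        (sym (trans (deg-shifted G k z) (trans (cong (k *_) deg-z) (ℤ.*-zeroʳ k))))

shifted-cokCard-suc : ∀ (G : Graph (suc m)) → Connected G → ∀ k → suc m ℕ.≤ suc k →
                  CokCard (shifted (+ suc k) (complement G)) (suc k ℕ.* ∣ charPolyAt G (+ suc m - + suc k) ∣)
shifted-cokCard-suc {m} G conn k le = cokCard-from-degree0 (shifted (+ suc k) (complement G)) k (deg-shifted G (+ suc k))
  (shifted-card₀ G (+ suc k) (subst (CokCard (charMatrix G (+ suc m - + suc k)))
    (cong ∣_∣ (sym (charPolyAt-det G (+ suc m - + suc k))))
    (cokCard-det m _ (charMatrix-nondegenerate G (+ suc k) conn (ℤ.i≤j⇒0≤j-i (ℤ.+≤+ le))))))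

-- The Picard group

module _ (G : Graph (suc m)) (kernel : ∀ x → (∀ w → app (lap G) x w ≡ 0ℤ) → ∀ u v → x u ≡ x v) where

  private
    L : Matrix (suc m)
    L = lap G

  reducedLap : Matrix m
  reducedLap j i = L (inject₁ j) (inject₁ i)

  app-reducedLap : ∀ x j → app reducedLap x j ≡ app L (ext x 0ℤ) (inject₁ j)
  app-reducedLap x j = sym (dot-ext-0 x (L (inject₁ j)))

  -- By symmetry, L applied to the extension of `y` by 0 vanishes off the last vertex, and there too
  -- since its degree is 0. The extension is therefore constant, with last entry 0.
  reducedLap-nondegenerate : Nondegenerate reducedLap
  reducedLap-nondegenerate y kills = ext-0-constant y (kernel ỹ
    (deg-determines {E = λ _ → 0ℤ} (trans (deg-lap G ỹ) (sym (Σ-zero (suc m)))) λ i → begin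
      app L ỹ (inject₁ i)                    ≡⟨ app-reducedLap y i ⟨
      app reducedLap y i                     ≡⟨ Σ-δ (app reducedLap y) i ⟨
      dot (app reducedLap y) (δ i)           ≡⟨ dot-app-sym reducedLap (λ u v → lap-sym G (inject₁ u) (inject₁ v)) (δ i) y ⟨
      dot y (app reducedLap (δ i))           ≡⟨ kills (δ i) ⟩
      0ℤ ∎))
    where
    open ≡-Reasoning
    ỹ : Div (suc m)
    ỹ = ext y 0ℤ

  -- The count by the minor of the matrix-tree theorem. It supplies some finite order for Pic⁰;
  -- `pic-order` then relates this order to that of coker (L + J).
  picEnum : Enum Degree0 (LinEquiv G) (Fin ∣ det m reducedLap ∣)
  picEnum with cokCard-det m reducedLap reducedLap-nondegenerate
  ... | enum f _ inj surj = enum (close ∘ f) (λ i → deg-close (f i)) g-inj g-surj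
    where
    g-inj : ∀ i j → LinEquiv G (close (f i)) (close (f j)) → i ≡ j
    g-inj i j (x , h) = inj i j (x′ , λ w → begin
      f i w - f j w
        ≡⟨ cong₂ _-_ (close-inject₁ (f i) w) (close-inject₁ (f j) w) ⟨
      close (f i) (inject₁ w) - close (f j) (inject₁ w)
        ≡⟨ h (inject₁ w) ⟩
      app L x (inject₁ w)
        ≡⟨ trans (cong (_-_ (app L x (inject₁ w))) (lap-constant G {λ _ → x (fromℕ m)} (λ _ _ → refl) (inject₁ w))) (ℤ.+-identityʳ _) ⟨
      app L x (inject₁ w) - app L (λ _ → x (fromℕ m)) (inject₁ w)
        ≡⟨ app-- L x (λ _ → x (fromℕ m)) (inject₁ w) ⟨
      app L (λ v → x v - x (fromℕ m)) (inject₁ w)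
        ≡⟨ app-congʳ L (last-elim (λ v → x v - x (fromℕ m) ≡ ext x′ 0ℤ v) (λ v → sym (ext-inject₁ x′ 0ℤ v))
             (trans (ℤ.+-inverseʳ (x (fromℕ m))) (sym (ext-last x′ 0ℤ)))) (inject₁ w) ⟩
      app L (ext x′ 0ℤ) (inject₁ w)
        ≡⟨ app-reducedLap x′ w ⟨
      app reducedLap x′ w ∎)
      where
      open ≡-Reasoning
      -- Subtracting the constant `x (fromℕ m)` does not change the image under L and makes the
      -- witness vanish at the deleted vertex.
      x′ : Fin m → ℤ
      x′ v = x (inject₁ v) - x (fromℕ m)
    g-surj : ∀ D → deg D ≡ 0ℤ → ∃[ i ] LinEquiv G D (close (f i))
    g-surj D d with surj (D ∘ inject₁) tt
    ... | i , x , h = i , ext x 0ℤ , deg-determines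
      (trans (trans (Σ-- D (close (f i))) (cong₂ _-_ d (deg-close (f i)))) (sym (deg-lap G (ext x 0ℤ))))
      (λ j → trans (cong (_-_ (D (inject₁ j))) (close-inject₁ (f i) j)) (trans (h j) (app-reducedLap x j)))

  -- L maps Div / (Div⁰ + ℤ·1), which is ℤ/n by the degree, isomorphically onto L(Div) / L(Div⁰).
  pic-card₀ : ∀ {N} → Enum Degree0 (LinEquiv G) (Fin N) → Card₀ (shifted (+ suc m) (complement G)) (suc m ℕ.* N)
  pic-card₀ {N} (enum f f₀ inj surj) = Enum-× (enum g g₀ g-inj g-surj)
    where
    T : Matrix (suc m)
    T = shifted (+ suc m) (complement G)
    app-T : ∀ x → deg x ≡ 0ℤ → ∀ w → app T x w ≡ app L x w
    app-T x d w = trans (app-shifted-deg0 G (+ suc m) x d w)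
      (trans (cong (λ t → app L x w + t * x w) (ℤ.+-inverseʳ (+ suc m))) (ℤ.+-identityʳ _))
    e : Div (suc m)
    e = δ zero
    g : Fin (suc m) × Fin N → Div (suc m)
    g (r , i) w = f i w + + toℕ r * app L e w
    g₀ : ∀ p → deg (g p) ≡ 0ℤ
    g₀ (r , i) = trans (deg-+* (f i) (app L e) (+ toℕ r))
      (trans (cong₂ (λ a b → a + + toℕ r * b) (f₀ i) (deg-lap G e)) (trans (ℤ.+-identityˡ _) (ℤ.*-zeroʳ (+ toℕ r))))
    g-inj : ∀ p q → Mod₀ T (g p) (g q) → p ≡ q
    g-inj (r , i) (s , j) (x , d , h) = finish (inj i j (y , λ w → trans (move (f i w) (f j w) (+ toℕ r) (+ toℕ s) (app L e w))
        (trans (cong (_+ (+ toℕ s - + toℕ r) * app L e w) (hL w)) (sym (app-+* L x e (+ toℕ s - + toℕ r) w)))))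
      where
      hL : ∀ w → g (r , i) w - g (s , j) w ≡ app L x w
      hL w = trans (h w) (app-T x d w)
      y : Div (suc m)
      y v = x v + (+ toℕ s - + toℕ r) * e v
      move : ∀ a b r s l → a - b ≡ (a + r * l) - (b + s * l) + (s - r) * l
      move = solve-∀
      finish : i ≡ j → (r , i) ≡ (s , j)
      -- For equal classes L y = 0, so `y` is constant and its degree s - r is a multiple of the
      -- number of vertices.
      finish refl = cong (_, i) (sym (proj₁ (residue-unique {+ suc m} s r (y zero) (begin
        + toℕ s - + toℕ r                                ≡⟨ trans (cong₂ _+_ d (ℤ.*-identityʳ (+ toℕ s - + toℕ r))) (ℤ.+-identityˡ _) ⟨
        deg x + (+ toℕ s - + toℕ r) * 1ℤ                 ≡⟨ cong (λ t → deg x + (+ toℕ s - + toℕ r) * t) (deg-δ {suc m} zero) ⟨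
        deg x + (+ toℕ s - + toℕ r) * deg e              ≡⟨ deg-+* x e (+ toℕ s - + toℕ r) ⟨
        deg y                                            ≡⟨ Σ-cong (λ v → kernel y y-kernel v zero) ⟩
        Σℤ (suc m) (λ _ → y zero)                        ≡⟨ trans (Σ-const (suc m) (y zero)) (ℤ.*-comm (+ suc m) (y zero)) ⟩
        y zero * + suc m                                 ∎))))
        where
        open ≡-Reasoning
        cancel : ∀ a r s l → (a + r * l) - (a + s * l) + (s - r) * l ≡ 0ℤ
        cancel = solve-∀
        y-kernel : ∀ w → app L y w ≡ 0ℤ
        y-kernel w = trans (app-+* L x e (+ toℕ s - + toℕ r) w)
          (trans (cong (_+ (+ toℕ s - + toℕ r) * app L e w) (sym (hL w)))
                 (cancel (f i w) (+ toℕ r) (+ toℕ s) (app L e w)))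
    g-surj : ∀ D → deg D ≡ 0ℤ → ∃[ p ] Mod₀ T D (g p)
    g-surj D d with surj D d
    ... | i , x , h with residue (deg x) (+ suc m) (λ ())
    ...   | r , q , eq = (r , i) , z , deg-z , λ w → begin
      D w - (f i w + + toℕ r * app L e w)
        ≡⟨ move (D w) (f i w) (+ toℕ r) (app L e w) q ⟩
      (D w - f i w) + - + toℕ r * app L e w + - q * 0ℤ
        ≡⟨ cong₂ (λ a b → a + - + toℕ r * app L e w + - q * b) (h w) (sym (lap-constant G {λ _ → 1ℤ} (λ _ _ → refl) w)) ⟩
      app L x w + - + toℕ r * app L e w + - q * app L (λ _ → 1ℤ) w
        ≡⟨ cong (_+ - q * app L (λ _ → 1ℤ) w) (app-+* L x e (- + toℕ r) w) ⟨
      app L z₁ w + - q * app L (λ _ → 1ℤ) w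
        ≡⟨ app-+* L z₁ (λ _ → 1ℤ) (- q) w ⟨
      app L z w
        ≡⟨ app-T z deg-z w ⟨
      app T z w ∎
      where
      open ≡-Reasoning
      -- Writing deg x = r + q n, with n the number of vertices, the divisor x - r e - q·1 has
      -- degree 0, and L does not see the multiple of 1.
      z₁ z : Div (suc m)
      z₁ v = x v + - + toℕ r * e v
      z v = z₁ v + - q * 1ℤ
      move : ∀ d f r l q → d - (f + r * l) ≡ (d - f) + - r * l + - q * 0ℤ
      move = solve-∀
      arith : ∀ r q n → (r + q * n) + - r * 1ℤ + - q * (n * 1ℤ) ≡ 0ℤ
      arith = solve-∀
      deg-z : deg z ≡ 0ℤ
      deg-z = trans (deg-+* z₁ (λ _ → 1ℤ) (- q)) (trans
        (cong₂ (λ a b → a + - q * b)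
          (trans (deg-+* x e (- + toℕ r)) (cong₂ (λ a b → a + - + toℕ r * b) eq (deg-δ {suc m} zero)))
          (Σ-const (suc m) 1ℤ))
        (arith (+ toℕ r) q (+ suc m)))

  pic-cokCard : ∀ {N} → Enum Degree0 (LinEquiv G) (Fin N) →
                CokCard (shifted (+ suc m) (complement G)) (suc m ℕ.* (suc m ℕ.* N))
  pic-cokCard p = cokCard-from-degree0 (shifted (+ suc m) (complement G)) m (deg-shifted G (+ suc m)) (pic-card₀ p)

-- Joins

Σ-split : ∀ m {n} (f : Fin (m ℕ.+ n) → ℤ) →
          Σℤ (m ℕ.+ n) f ≡ Σℤ m (λ a → f (a ↑ˡ n)) + Σℤ n (λ b → f (m ↑ʳ b))
Σ-split zero    f = sym (ℤ.+-identityˡ _)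
Σ-split (suc m) f = trans (cong (_+_ (f zero)) (Σ-split m (f ∘ suc))) (sym (ℤ.+-assoc (f zero) _ _))

split-elim : ∀ m {n} (P : Fin (m ℕ.+ n) → Set) → (∀ a → P (a ↑ˡ n)) → (∀ b → P (m ↑ʳ b)) → ∀ w → P w
split-elim zero    P l r w       = r w
split-elim (suc m) P l r zero    = l zero
split-elim (suc m) P l r (suc w) = split-elim m (P ∘ suc) (l ∘ suc) r w

glue : (Fin m → ℤ) → (Fin n → ℤ) → Fin (m ℕ.+ n) → ℤ
glue {m} x y w = [ x , y ]′ (splitAt m w)

glue-↑ˡ : ∀ (x : Fin m → ℤ) (y : Fin n → ℤ) a → glue x y (a ↑ˡ n) ≡ x a
glue-↑ˡ {m} {n} x y a = cong [ x , y ]′ (Fin.splitAt-↑ˡ m a n)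

glue-↑ʳ : ∀ (x : Fin m → ℤ) (y : Fin n → ℤ) b → glue x y (m ↑ʳ b) ≡ y b
glue-↑ʳ {m} {n} x y b = cong [ x , y ]′ (Fin.splitAt-↑ʳ m n b)

blocks : Matrix m → Matrix n → Fin m ⊎ Fin n → Fin m ⊎ Fin n → ℤ
blocks A B (inj₁ a) = [ A a , (λ _ → 0ℤ) ]′
blocks A B (inj₂ b) = [ (λ _ → 0ℤ) , B b ]′

infixr 6 _⊕_
_⊕_ : Matrix m → Matrix n → Matrix (m ℕ.+ n)
_⊕_ {m} A B u v = blocks A B (splitAt m u) (splitAt m v)

module _ (A : Matrix m) (B : Matrix n) where

  ⊕-↑ˡ : ∀ a v → (A ⊕ B) (a ↑ˡ n) v ≡ glue (A a) (λ _ → 0ℤ) v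
  ⊕-↑ˡ a v rewrite Fin.splitAt-↑ˡ m a n = refl

  ⊕-↑ʳ : ∀ b v → (A ⊕ B) (m ↑ʳ b) v ≡ glue (λ _ → 0ℤ) (B b) v
  ⊕-↑ʳ b v rewrite Fin.splitAt-↑ʳ m n b = refl

  app-⊕-↑ˡ : ∀ x a → app (A ⊕ B) x (a ↑ˡ n) ≡ app A (λ v → x (v ↑ˡ n)) a
  app-⊕-↑ˡ x a = trans (Σ-split m (λ v → x v * (A ⊕ B) (a ↑ˡ n) v)) (trans (cong₂ _+_
    (Σ-cong (λ v → cong (x (v ↑ˡ n) *_) (trans (⊕-↑ˡ a (v ↑ˡ n)) (glue-↑ˡ (A a) (λ _ → 0ℤ) v))))
    (Σ-vanish (λ v → trans (cong (x (m ↑ʳ v) *_) (trans (⊕-↑ˡ a (m ↑ʳ v)) (glue-↑ʳ (A a) (λ _ → 0ℤ) v))) (ℤ.*-zeroʳ (x (m ↑ʳ v))))))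
    (ℤ.+-identityʳ _))

  app-⊕-↑ʳ : ∀ x b → app (A ⊕ B) x (m ↑ʳ b) ≡ app B (λ v → x (m ↑ʳ v)) b
  app-⊕-↑ʳ x b = trans (Σ-split m (λ v → x v * (A ⊕ B) (m ↑ʳ b) v)) (trans (cong₂ _+_
    (Σ-vanish (λ v → trans (cong (x (v ↑ˡ n) *_) (trans (⊕-↑ʳ b (v ↑ˡ n)) (glue-↑ˡ (λ _ → 0ℤ) (B b) v))) (ℤ.*-zeroʳ (x (v ↑ˡ n)))))
    (Σ-cong (λ v → cong (x (m ↑ʳ v) *_) (trans (⊕-↑ʳ b (m ↑ʳ v)) (glue-↑ʳ {m} (λ _ → 0ℤ) (B b) v)))))
    (ℤ.+-identityˡ _))

  CokCard-⊕ : ∀ {M N} → CokCard A M → CokCard B N → CokCard (A ⊕ B) (M ℕ.* N)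
  CokCard-⊕ (enum f _ f-inj f-surj) (enum g _ g-inj g-surj) = Enum-× (enum
    (λ (i , j) → glue (f i) (g j)) (λ _ → tt)
    (λ (i , j) (i′ , j′) (x , h) → cong₂ _,_
      (f-inj i i′ ((λ v → x (v ↑ˡ n)) , λ w → trans (sym (cong₂ _-_ (glue-↑ˡ (f i) (g j) w) (glue-↑ˡ (f i′) (g j′) w)))
         (trans (h (w ↑ˡ n)) (app-⊕-↑ˡ x w))))
      (g-inj j j′ ((λ v → x (m ↑ʳ v)) , λ w → trans (sym (cong₂ _-_ (glue-↑ʳ (f i) (g j) w) (glue-↑ʳ (f i′) (g j′) w)))
         (trans (h (m ↑ʳ w)) (app-⊕-↑ʳ x w)))))
    λ D _ → let i , x , h = f-surj (λ a → D (a ↑ˡ n)) tt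
                j , y , k = g-surj (λ b → D (m ↑ʳ b)) tt
      in (i , j) , glue x y , split-elim m (λ w → D w - glue (f i) (g j) w ≡ app (A ⊕ B) (glue x y) w)
        (λ a → trans (cong (_-_ (D (a ↑ˡ n))) (glue-↑ˡ (f i) (g j) a))
          (trans (h a) (sym (trans (app-⊕-↑ˡ (glue x y) a) (app-congʳ A (glue-↑ˡ x y) a)))))
        (λ b → trans (cong (_-_ (D (m ↑ʳ b))) (glue-↑ʳ (f i) (g j) b))
          (trans (k b) (sym (trans (app-⊕-↑ʳ (glue x y) b) (app-congʳ B (glue-↑ʳ x y) b))))))

δ-⊕ : ∀ m {n} u v → δ {m ℕ.+ n} u v ≡ (δ {m} ⊕ δ {n}) u v
δ-⊕ zero    u v = refl
δ-⊕ (suc m) zero zero = refl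
δ-⊕ (suc m) {n} zero (suc v) with splitAt m {n} v
... | inj₁ _ = refl
... | inj₂ _ = refl
δ-⊕ (suc m) {n} (suc u) zero with splitAt m {n} u
... | inj₁ _ = refl
... | inj₂ _ = refl
δ-⊕ (suc m) {n} (suc u) (suc v) = trans (δ-⊕ m {n} u v) step-in
  where
  step-in : (δ {m} ⊕ δ {n}) u v ≡ (δ {suc m} ⊕ δ {n}) (suc u) (suc v)
  step-in with splitAt m {n} u | splitAt m {n} v
  ... | inj₁ _ | inj₁ _ = refl
  ... | inj₁ _ | inj₂ _ = refl
  ... | inj₂ _ | inj₁ _ = refl
  ... | inj₂ _ | inj₂ _ = refl

shifted-cong : ∀ k {c c′ : Matrix n} → (∀ u v → c u v ≡ c′ u v) → ∀ u v → shifted k c u v ≡ shifted k c′ u v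
shifted-cong k h u v = cong₂ (λ s a → δ u v * (k - s) + a) (Σ-cong (h v)) (h u v)

rowSum-⊕ : ∀ (A : Matrix m) (B : Matrix n) v →
           Σℤ (m ℕ.+ n) ((A ⊕ B) v) ≡ glue (λ a → Σℤ m (A a)) (λ b → Σℤ n (B b)) v
rowSum-⊕ {m} {n} A B = split-elim m _
  (λ a → trans (ones ((A ⊕ B) (a ↑ˡ n))) (trans (app-⊕-↑ˡ A B (λ _ → 1ℤ) a) (trans (sym (ones (A a)))
    (sym (glue-↑ˡ (λ a → Σℤ m (A a)) (λ b → Σℤ n (B b)) a)))))
  (λ b → trans (ones ((A ⊕ B) (m ↑ʳ b))) (trans (app-⊕-↑ʳ A B (λ _ → 1ℤ) b) (trans (sym (ones (B b)))
    (sym (glue-↑ʳ (λ a → Σℤ m (A a)) (λ b → Σℤ n (B b)) b)))))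
  where
  ones : ∀ {p} (f : Fin p → ℤ) → Σℤ p f ≡ Σℤ p (λ i → 1ℤ * f i)
  ones f = Σ-cong (λ i → sym (ℤ.*-identityˡ (f i)))

-- `shifted` involves its matrix only through entries and row sums, and zero blocks do not alter row
-- sums; so `k` passes to the blocks unchanged.
shifted-⊕ : ∀ k (A : Matrix m) (B : Matrix n) u v → shifted k (A ⊕ B) u v ≡ (shifted k A ⊕ shifted k B) u v
shifted-⊕ {m} {n} k A B u v =
  trans (cong₂ (λ e s → e * (k - s) + (A ⊕ B) u v) (δ-⊕ m {n} u v) (rowSum-⊕ A B v)) blockwise
  where
  blockwise : (δ {m} ⊕ δ {n}) u v * (k - glue (λ a → Σℤ m (A a)) (λ b → Σℤ n (B b)) v) + (A ⊕ B) u v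
         ≡ (shifted k A ⊕ shifted k B) u v
  blockwise with splitAt m u | splitAt m v
  ... | inj₁ _ | inj₁ _ = refl
  ... | inj₁ _ | inj₂ _ = refl
  ... | inj₂ _ | inj₁ _ = refl
  ... | inj₂ _ | inj₂ _ = refl

⊕-cong : ∀ {A A′ : Matrix m} {B B′ : Matrix n} → (∀ u v → A u v ≡ A′ u v) → (∀ u v → B u v ≡ B′ u v) →
         ∀ u v → (A ⊕ B) u v ≡ (A′ ⊕ B′) u v
⊕-cong {m} h k u v with splitAt m u | splitAt m v
... | inj₁ a | inj₁ b = h a b
... | inj₁ _ | inj₂ _ = refl
... | inj₂ _ | inj₁ _ = refl
... | inj₂ a | inj₂ b = k a b

blockDiag : ∀ {l} (ks : Vec ℕ l) → (∀ i → Matrix (lookup ks i)) → Matrix (sum ks)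
blockDiag []       A = λ ()
blockDiag (k ∷ ks) A = A zero ⊕ blockDiag ks (A ∘ suc)

shifted-blockDiag : ∀ {l} (ks : Vec ℕ l) k (A : ∀ i → Matrix (lookup ks i)) u v →
                    shifted k (blockDiag ks A) u v ≡ blockDiag ks (λ i → shifted k (A i)) u v
shifted-blockDiag (_ ∷ ks) k A u v = trans (shifted-⊕ k (A zero) (blockDiag ks (A ∘ suc)) u v)
  (⊕-cong (λ _ _ → refl) (shifted-blockDiag ks k (A ∘ suc)) u v)

CokCard-blockDiag : ∀ {l} (ks : Vec ℕ l) {A : ∀ i → Matrix (lookup ks i)} {N : Fin l → ℕ} →
                    (∀ i → CokCard (A i) (N i)) → CokCard (blockDiag ks A) (Πℕ l N)
CokCard-blockDiag []       h = enum (λ _ ()) (λ _ → tt) (λ { zero zero _ → refl }) λ D _ → zero , (λ ()) , λ ()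
CokCard-blockDiag (_ ∷ ks) h = CokCard-⊕ _ _ (h zero) (CokCard-blockDiag ks (h ∘ suc))

-- Constancy on each block would not compare different blocks. The conclusion fixes the value
-- through the common `t`, and so it holds across all of them.
blockDiag-solve-constant : ∀ {l} (ks : Vec ℕ l) {A : ∀ i → Matrix (lookup ks i)} k t →
  (∀ i x → (∀ w → app (A i) x w ≡ t) → ∀ w → k * x w ≡ t) →
  ∀ x → (∀ w → app (blockDiag ks A) x w ≡ t) → ∀ w → k * x w ≡ t
blockDiag-solve-constant (m ∷ ks) {A} k t h x e = split-elim m (λ w → k * x w ≡ t)
  (h zero (λ a → x (a ↑ˡ sum ks)) (λ a → trans (sym (app-⊕-↑ˡ (A zero) _ x a)) (e (a ↑ˡ sum ks))))
  (blockDiag-solve-constant ks k t (h ∘ suc) (λ b → x (m ↑ʳ b)) (λ b → trans (sym (app-⊕-↑ʳ (A zero) _ x b)) (e (m ↑ʳ b))))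

joinAdj-suc : ∀ {l} k (ks : Vec ℕ l) (Γ : ∀ i → Graph (lookup (k ∷ ks) i)) p q →
              joinAdj (k ∷ ks) Γ (suc (proj₁ p) , proj₂ p) (suc (proj₁ q) , proj₂ q) ≡ joinAdj ks (Γ ∘ suc) p q
joinAdj-suc k ks Γ (i , a) (j , b) with i ≟ j
... | yes refl = refl
... | no _     = refl

-- The complement is the all-ones matrix minus the adjacency matrix, diagonal included, so every
-- entry between different blocks is 1 - 1.
complement-join : ∀ {l} (ks : Vec ℕ l) (Γ : ∀ i → Graph (lookup ks i)) u v →
                  complement (join ks Γ) u v ≡ blockDiag ks (λ i → complement (Γ i)) u v
complement-join (k ∷ ks) Γ u v with splitAt k u | splitAt k v
... | inj₁ a | inj₁ b = refl
... | inj₁ a | inj₂ b = refl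
... | inj₂ a | inj₁ b = refl
... | inj₂ a | inj₂ b = trans (cong (λ t → 1ℤ - b2ℤ t) (joinAdj-suc k ks Γ (decode ks a) (decode ks b))) (complement-join ks (Γ ∘ suc) a b)

lookup≤sum : ∀ {l} (ks : Vec ℕ l) i → lookup ks i ℕ.≤ sum ks
lookup≤sum (k ∷ ks) zero    = ℕ.m≤m+n k (sum ks)
lookup≤sum (k ∷ ks) (suc i) = ℕ.≤-trans (lookup≤sum ks i) (ℕ.m≤n+m (sum ks) k)

Π-factor : ∀ l k (f : Fin l → ℕ) → Πℕ l (λ i → k ℕ.* f i) ≡ k ℕ.^ l ℕ.* Πℕ l f
Π-factor zero    k f = refl
Π-factor (suc l) k f = trans (cong (k ℕ.* f zero ℕ.*_) (Π-factor l k (f ∘ suc)))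
  (ℕ.[m*n]*[o*p]≡[m*o]*[n*p] k (f zero) (k ℕ.^ l) (Πℕ l (f ∘ suc)))

shifted-join : ∀ {l} (ks : Vec ℕ l) (Γ : ∀ i → Graph (lookup ks i)) k u v →
               shifted k (complement (join ks Γ)) u v ≡ blockDiag ks (λ i → shifted k (complement (Γ i))) u v
shifted-join ks Γ k u v = trans (shifted-cong k (complement-join ks Γ) u v) (shifted-blockDiag ks k (λ i → complement (Γ i)) u v)

shifted-cokCard : ∀ (G : Graph n) → n ℕ.≥ 1 → Connected G → ∀ {k} → n ℕ.≤ k →
                  CokCard (shifted (+ k) (complement G)) (k ℕ.* ∣ charPolyAt G (+ n - + k) ∣)
shifted-cokCard {suc m} G _ conn {suc k} = shifted-cokCard-suc G conn k

-- Kernel and cokernel for the join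

module _ {l} (ks : Vec ℕ l) (Γ : ∀ i → Graph (lookup ks i)) (conn : ∀ i → Connected (Γ i)) where

  -- If L x = 0 then (L + J) x is the constant deg x, and this equation is solved block by block,
  -- using only the connectedness of the individual graphs.
  join-kernel : ∀ x → (∀ w → app (lap (join ks Γ)) x w ≡ 0ℤ) → ∀ w → + sum ks * x w ≡ deg x
  join-kernel x h = blockDiag-solve-constant ks (+ sum ks) (deg x)
    (λ i y → shifted-solve-constant (Γ i) (conn i) (+ sum ks) (ℤ.i≤j⇒0≤j-i (ℤ.+≤+ (lookup≤sum ks i))) y (deg x))
    x λ w → begin
      app (blockDiag ks (λ i → shifted (+ sum ks) (complement (Γ i)))) x w
        ≡⟨ app-cong (shifted-join ks Γ (+ sum ks)) x w ⟨
      app (shifted (+ sum ks) (complement (join ks Γ))) x w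
        ≡⟨ app-shifted (join ks Γ) (+ sum ks) x w ⟩
      app (lap (join ks Γ)) x w + (+ sum ks - + sum ks) * x w + deg x
        ≡⟨ cong₂ (λ a s → a + s * x w + deg x) (h w) (ℤ.+-inverseʳ (+ sum ks)) ⟩
      0ℤ + 0ℤ * x w + deg x
        ≡⟨ ℤ.+-identityˡ (deg x) ⟩
      deg x ∎
    where open ≡-Reasoning

  join-cokCard : (∀ i → lookup ks i ℕ.≥ 1) →
                 CokCard (shifted (+ sum ks) (complement (join ks Γ)))
                         (sum ks ℕ.^ l ℕ.* Πℕ l (λ i → ∣ charPolyAt (Γ i) (+ lookup ks i - + sum ks) ∣))
  join-cokCard pos = subst (CokCard (shifted (+ sum ks) (complement (join ks Γ))))
    (Π-factor l (sum ks) (λ i → ∣ charPolyAt (Γ i) (+ lookup ks i - + sum ks) ∣))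
    (CokCard-cong (λ u v → sym (shifted-join ks Γ (+ sum ks) u v)) (CokCard-blockDiag ks λ i →
      shifted-cokCard (Γ i) (pos i) (conn i) (lookup≤sum ks i)))

-- The two sides of the equation are orders of the same cokernel, and the order of a cokernel is
-- unique.
pic-order : ∀ {n} (G : Graph n) → n ℕ.≥ 1 → (∀ x → (∀ w → app (lap G) x w ≡ 0ℤ) → ∀ w → + n * x w ≡ deg x) →
            ∀ {C} → CokCard (shifted (+ n) (complement G)) C → Σ[ N ∈ ℕ ] (PicCard G N × n ℕ.* (n ℕ.* N) ≡ C)
pic-order {suc m} G _ kernel card =
  let pic = picEnum G const in
  _ , (Enum.rep pic , Enum.rep-in pic , Enum.injective pic , Enum.surjective pic) ,
  CokCard-unique (shifted (+ suc m) (complement G)) (pic-cokCard G const pic) card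
  where
  const : ∀ x → (∀ w → app (lap G) x w ≡ 0ℤ) → ∀ u v → x u ≡ x v
  const x h u v = ℤ.*-cancelˡ-≡ (+ suc m) (x u) (x v) (trans (kernel x h u) (sym (kernel x h v)))

theoremC : (l : ℕ) → l ℕ.≥ 1 → (ks : Vec ℕ l) → (Γ : (i : Fin l) → Graph (lookup ks i)) →
           (∀ i → lookup ks i ℕ.≥ 1) → (∀ i → Connected (Γ i)) →
           Σ[ N ∈ ℕ ] (PicCard (join ks Γ) N
             × sum ks ℕ.* N ≡ sum ks ℕ.^ (l ℕ.∸ 1)
                 ℕ.* Πℕ l (λ i → ∣ charPolyAt (Γ i) (+ lookup ks i - + sum ks) ∣))
theoremC (suc l) _ ks@(_ ∷ _) Γ pos conn =
  -- Here `eq` reads k (k N) = k^(l+1) times the product, where l + 1 is the number of graphs. One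
  -- factor k is cancelled; the other stays on the left, because for a single graph the exponent of
  -- the quotient would be negative.
  let N , pic , eq = pic-order (join ks Γ) k≥1 (join-kernel ks Γ conn) (join-cokCard ks Γ conn pos)
  in N , pic , ℕ.*-cancelˡ-≡ _ _ k (trans eq (ℕ.*-assoc k (k ℕ.^ l) _))
  where
  k = sum ks
  k≥1 : k ℕ.≥ 1
  k≥1 = ℕ.≤-trans (pos zero) (lookup≤sum ks zero)
  instance _ = ℕ.>-nonZero k≥1
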